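{- For all integers $n\geq 0$, $$a_{1^{2}2^{ -1}5^{ -2}}(5n)>0,\quad a_{1^{2}2^{ -1}5^{ -2}}(5n+1)<0,\quad a_{1^{2}2^{ -1}5^{ -2}}(5n+2)=0,$$ $$a_{1^{2}2^{ -1}5^{ -2}}(5n+3)=0,\quad a_{1^{2}2^{ -1}5^{ -2}}(5n+4)>0.$$
   Context: For $|q|<1$ (or as formal power series in $q$) let $f_j:=(q^j;q^j)_\infty=\prod_{k\ge 1}(1-q^{jk})$ for each positive integer $j$. The integers $a_{1^{2}2^{ -1}5^{ -2}}(n)$, $n\ge 0$, are defined by $\sum_{n=0}^\infty a_{1^{2}2^{ -1}5^{ -2}}(n)q^n=\dfrac{f_1^2}{f_2f_5^2}$. -}

module Defs where

open import Data.Fin.Base using (Fin; zero; suc; toℕ; fromℕ; inject₁)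
open import Data.Fin.Properties using (toℕ<n; toℕ-inject₁; toℕ-fromℕ)
open import Data.Integer.Base using (ℤ; 0ℤ; 1ℤ; _+_; _*_; _-_; -_)
open import Data.Integer.Properties as ℤ using (+-0-commutativeMonoid)
open import Data.Nat.Base as ℕ using (ℕ; zero; suc; NonZero; _∸_; _≤_; _<_; s≤s)
import Data.Nat.Properties as ℕ
open import Data.Vec.Functional using (Vector; _∷_)
open import Relation.Binary.PropositionalEquality using (_≡_; _≗_; refl; sym; trans; cong; cong₂; module ≡-Reasoning)
open import Relation.Nullary.Decidable using (⌊_⌋; dec-no)
open import Data.Bool.Base using (if_then_else_)

open import Algebra.Properties.CommutativeMonoid.Sum +-0-commutativeMonoid using (sum-syntax; sum⁺-syntax; sum-cong-≗; sum-replicate-zero; sum-init-last)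

-- The series Σ p(n) qⁿ is represented by n ↦ p(n).
PowerSeries : Set
PowerSeries = ℕ → ℤ

q^_ : ℕ → PowerSeries
(q^ m) n = if ⌊ n ℕ.≟ m ⌋ then 1ℤ else 0ℤ

1ₛ : PowerSeries
1ₛ = q^ 0

infixl 6 _⊖_
infixl 7 _⊛_ _⊘_

_⊖_ : PowerSeries → PowerSeries → PowerSeries
(p ⊖ r) n = p n - r n

_⊛_ : PowerSeries → PowerSeries → PowerSeries
(p ⊛ r) n = ∑[ i ≤ n ] (p (toℕ i) * r (n ∸ toℕ i))

-- For p with constant term 1, the coefficients of 1/p in the order
-- n, n-1, …, 0, from (1/p)(n+1) = - Σ_{i ≤ n} p(i+1) (1/p)(n-i).
recipUpTo : PowerSeries → (n : ℕ) → Vector ℤ (suc n)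
recipUpTo p zero    = λ _ → 1ℤ
recipUpTo p (suc n) = (- (∑[ i ≤ n ] (p (suc (toℕ i)) * recipUpTo p n i))) ∷ recipUpTo p n

-- Meaningful only when p has constant term 1; see ⊛-recip.
recip : PowerSeries → PowerSeries
recip p n = recipUpTo p n zero

_⊘_ : PowerSeries → PowerSeries → PowerSeries
p ⊘ r = p ⊛ recip r

-- ∏_{k=1}^{N} (1 - q^{jk})
partialProduct : ℕ → ℕ → PowerSeries
partialProduct j zero    = 1ₛ
partialProduct j (suc N) = partialProduct j N ⊛ (1ₛ ⊖ q^ (j ℕ.* suc N))

-- f_j = (q^j; q^j)_∞.  Multiplying by 1 - q^{jk} with k > n does not change the
-- coefficient of qⁿ, so that coefficient of the infinite product is the one in
-- the n-th partial product; see partialProduct-stable.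
f : (j : ℕ) → .{{NonZero j}} → PowerSeries
f j n = partialProduct j n n

-- The coefficients of f₁² / (f₂ f₅²).
a : PowerSeries
a = (f 1 ⊛ f 1) ⊘ (f 2 ⊛ (f 5 ⊛ f 5))

recipUpTo-recip : ∀ p n (i : Fin (suc n)) → recipUpTo p n i ≡ recip p (n ∸ toℕ i)
recipUpTo-recip p zero    zero    = refl
recipUpTo-recip p (suc n) zero    = refl
recipUpTo-recip p (suc n) (suc i) = recipUpTo-recip p n i

⊛-recip : ∀ p → p 0 ≡ 1ℤ → p ⊛ recip p ≗ 1ₛ
⊛-recip p p₀≡1 zero rewrite p₀≡1 = refl
⊛-recip p p₀≡1 (suc n) = begin
  p 0 * (- s) + t      ≡⟨ cong (λ x → x * (- s) + t) p₀≡1 ⟩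
  1ℤ * (- s) + t       ≡⟨ cong (_+ t) (ℤ.*-identityˡ (- s)) ⟩
  - s + t              ≡⟨ cong (- s +_) t≡s ⟩
  - s + s              ≡⟨ ℤ.+-inverseˡ s ⟩
  0ℤ                   ∎
  where
  open ≡-Reasoning
  s = ∑[ i ≤ n ] (p (suc (toℕ i)) * recipUpTo p n i)
  t = ∑[ i ≤ n ] (p (suc (toℕ i)) * recip p (n ∸ toℕ i))
  t≡s : t ≡ s
  t≡s = sum-cong-≗ {suc n} λ i → cong (p (suc (toℕ i)) *_) (sym (recipUpTo-recip p n i))

q^-≢ : ∀ {m n} → n < m → (q^ m) n ≡ 0ℤ
q^-≢ {m} {n} n<m rewrite dec-no (n ℕ.≟ m) (ℕ.<⇒≢ n<m) = refl

⊛-1⊖q^ : ∀ p {m n} → n < m → (p ⊛ (1ₛ ⊖ q^ m)) n ≡ p n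
⊛-1⊖q^ p {m} {n} n<m = begin
  ∑[ i ≤ n ] t i                           ≡⟨ sum-init-last t ⟩
  (∑[ i < n ] t (inject₁ i)) + t (fromℕ n) ≡⟨ cong₂ _+_ (trans (sum-cong-≗ {n} init≡0) (sum-replicate-zero n)) last≡ ⟩
  0ℤ + p n                                 ≡⟨ ℤ.+-identityˡ (p n) ⟩
  p n                                      ∎
  where
  open ≡-Reasoning
  r = 1ₛ ⊖ q^ m
  t : Vector ℤ (suc n)
  t i = p (toℕ i) * r (n ∸ toℕ i)
  r≡1 : r 0 ≡ 1ℤ
  r≡1 rewrite q^-≢ {m} {0} (ℕ.≤-<-trans ℕ.z≤n n<m) = refl
  r≡0 : ∀ k → 0 < k → k < m → r k ≡ 0ℤ
  r≡0 (suc k) _ k<m rewrite q^-≢ k<m = refl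
  init≡0 : ∀ i → t (inject₁ i) ≡ 0ℤ
  init≡0 i rewrite toℕ-inject₁ i
                 | r≡0 (n ∸ toℕ i) (ℕ.m<n⇒0<n∸m (toℕ<n i)) (ℕ.≤-<-trans (ℕ.m∸n≤m n (toℕ i)) n<m)
                 = ℤ.*-zeroʳ (p (toℕ i))
  last≡ : t (fromℕ n) ≡ p n
  last≡ rewrite toℕ-fromℕ n | ℕ.n∸n≡0 n | r≡1 = ℤ.*-identityʳ (p n)

partialProduct-stable : ∀ j .{{_ : NonZero j}} {n N} → n ≤ N → partialProduct j N n ≡ f j n
partialProduct-stable j {n} n≤N = go (ℕ.≤⇒≤′ n≤N)
  where
  go : ∀ {N} → n ℕ.≤′ N → partialProduct j N n ≡ f j n
  go ℕ.≤′-refl = refl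
  go (ℕ.≤′-step {N} n≤′N) =
    trans (⊛-1⊖q^ (partialProduct j N) (ℕ.<-≤-trans (s≤s (ℕ.≤′⇒≤ n≤′N)) (ℕ.m≤n*m (suc N) j)))
          (go n≤′N)

{-# OPTIONS --safe #-}

-- Jacobi's triple product gives f₁²/f₂ = Σ_{m ∈ ℤ} (-1)^m q^(m²), and sorting m by its residue modulo 5 gives
--   f₁²/f₂ = θ(5,5)(q⁵) - 2q θ(7,3)(q⁵) + 2q⁴ θ(9,1)(q⁵),
--   θ(u,v) = Σ_{m ∈ ℤ} (-1)^m q^(u m(m+1)/2 + v m(m-1)/2) = (q^u; q^(u+v))_∞ (q^v; q^(u+v))_∞ (q^(u+v); q^(u+v))_∞.
-- As 1/f₅² is a series in q⁵, the five progressions read off the coefficients of θ(5,5)/f₁², -2θ(7,3)/f₁²,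
-- 0, 0 and 2θ(9,1)/f₁².  All coefficients of θ(u,v)/f₁² are positive when u + v = 10: the factors of θ(u,v)
-- cancel against those of f₁², and a factor 1/(1 - q) survives.
--
-- The triple product comes from its finite form, a sum of Gaussian binomial coefficients, and every identity
-- is proved in the ring of series modulo q^(K+1), where finite sums and products suffice.
module Submission where

open import Algebra.Bundles using (CommutativeRing)
import Algebra.Properties.Ring
open import Algebra.Structures using (IsCommutativeRing)
import Algebra.Solver.Ring as RingSolver
open import Algebra.Solver.Ring.AlmostCommutativeRing using (_-Raw-AlmostCommutative⟶_; fromCommutativeRing; Induced-equivalence)
open import Data.Bool.Base using (if_then_else_)
import Data.Integer.Properties as ℤ
import Data.Integer.Tactic.RingSolver as ℤ
open import Data.Maybe.Base using (just; nothing)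
open import Data.Nat.Base as ℕ using (ℕ; zero; suc; NonZero; z≤n; s≤s)
open import Data.Nat.Induction using (<-rec)
import Data.Nat.Properties as ℕ
import Data.Nat.Tactic.RingSolver as ℕ
open import Data.Product.Base using (_×_; _,_)
open import Data.Sum.Base using (_⊎_; inj₁; inj₂)
open import Function.Base using (_∘_; flip)
open import Relation.Binary.Definitions using (WeaklyDecidable)
import Relation.Binary.Reasoning.Setoid
open import Relation.Binary.PropositionalEquality as ≡ using (_≡_)
open import Relation.Nullary.Decidable using (Dec; yes; no; True; toWitness; isYes≗does)

-- The triple product in a commutative ring

-- The triple product is used in both directions. The dissection needs f₁²/f₂ as a sum, since only
-- the exponents m² can be sorted modulo 5. Positivity needs the pieces θ(u,v) as products again,
-- because their sums alternate in sign and say nothing about the signs after division by f₁². The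
-- usual statement has a variable z together with 1/z, and power series in q have no negative
-- exponents. The finite form is therefore stated for two sequences of ring elements, linked only by
-- the rule that a product of their members is a power of the base. The passage to the limit becomes
-- stabilisation: modulo q^(K+1) long products stop changing and distant theta terms are zero, so
-- one sufficiently long finite identity is already the infinite one. The three products in θ(u,v)
-- are shared out between the two copies of f₁ in f₁². A single copy could not absorb them: for u =
-- v = 5 the same factors occur twice.

module RingWithIntegers {c ℓ} (R : CommutativeRing c ℓ)
  (integers : CommutativeRing.rawRing ℤ.+-*-commutativeRing -Raw-AlmostCommutative⟶ fromCommutativeRing R) where

  open CommutativeRing R
  open _-Raw-AlmostCommutative⟶_ integers using (⟦_⟧)

  -- The solver compares coefficients in ℤ, so that it can cancel terms without deciding equality in
  -- `R`.
  coefficient-≟ : WeaklyDecidable (Induced-equivalence integers)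
  coefficient-≟ i j with i ℤ.≟ j
  ... | yes i≡j = just (reflexive (≡.cong ⟦_⟧ i≡j))
  ... | no  _   = nothing

  open RingSolver (CommutativeRing.rawRing ℤ.+-*-commutativeRing) (fromCommutativeRing R) integers coefficient-≟ public
    using (solve; _:+_; _:*_; _:-_; :-_; _:=_)

  ∏ : (ℕ → Carrier) → ℕ → Carrier
  ∏ h zero    = 1#
  ∏ h (suc n) = ∏ h n * h n

  antidiagonal : (ℕ → ℕ → Carrier) → ℕ → Carrier
  antidiagonal t zero    = t 0 0
  antidiagonal t (suc n) = t 0 (suc n) + antidiagonal (t ∘ suc) n

  -- For `u i` = x p^i this is (-1)^m x^m p^(m(m-1)/2), a term of the theta series in x.
  signedPower : (ℕ → Carrier) → ℕ → Carrier
  signedPower u zero    = 1#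
  signedPower u (suc m) = - (u m * signedPower u m)

  symmetricSum : (ℕ → Carrier) → (ℕ → Carrier) → ℕ → Carrier
  symmetricSum u v zero    = 1#
  symmetricSum u v (suc N) = symmetricSum u v N + (signedPower u (suc N) + signedPower v (suc N))

module JacobiTripleProduct {c ℓ} (R : CommutativeRing c ℓ)
  (integers : CommutativeRing.rawRing ℤ.+-*-commutativeRing -Raw-AlmostCommutative⟶ fromCommutativeRing R) where

  open CommutativeRing R
  open RingWithIntegers R integers
  open Algebra.Properties.Ring ring using (-‿distribˡ-*)
  open Relation.Binary.Reasoning.Setoid setoid

  [1-x]*y≈y-x*y : ∀ x y → (1# - x) * y ≈ y - x * y
  [1-x]*y≈y-x*y x y = begin
    (1# - x) * y       ≈⟨ distribʳ y 1# (- x) ⟩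
    1# * y + - x * y   ≈⟨ +-cong (*-identityˡ y) (sym (-‿distribˡ-* x y)) ⟩
    y - x * y          ∎

  antidiagonal-cong : ∀ {t t′} n → (∀ i j → i ℕ.+ j ≡ n → t i j ≈ t′ i j) → antidiagonal t n ≈ antidiagonal t′ n
  antidiagonal-cong zero    t≈t′ = t≈t′ 0 0 ≡.refl
  antidiagonal-cong (suc n) t≈t′ = +-cong (t≈t′ 0 (suc n) ≡.refl)
    (antidiagonal-cong n λ i j i+j≡n → t≈t′ (suc i) j (≡.cong suc i+j≡n))

  antidiagonal-last : ∀ t n → antidiagonal t (suc n) ≈ antidiagonal (λ i j → t i (suc j)) n + t (suc n) 0
  antidiagonal-last t zero    = refl
  antidiagonal-last t (suc n) = begin
    t 0 (2 ℕ.+ n) + antidiagonal (t ∘ suc) (suc n)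
      ≈⟨ +-congˡ (antidiagonal-last (t ∘ suc) n) ⟩
    t 0 (2 ℕ.+ n) + (antidiagonal (λ i j → t (suc i) (suc j)) n + t (2 ℕ.+ n) 0)
      ≈⟨ +-assoc _ _ _ ⟨
    t 0 (2 ℕ.+ n) + antidiagonal (λ i j → t (suc i) (suc j)) n + t (2 ℕ.+ n) 0 ∎

  antidiagonal-flip : ∀ t n → antidiagonal t n ≈ antidiagonal (flip t) n
  antidiagonal-flip t zero    = refl
  antidiagonal-flip t (suc n) = begin
    t 0 (suc n) + antidiagonal (t ∘ suc) n         ≈⟨ +-congˡ (antidiagonal-flip (t ∘ suc) n) ⟩
    t 0 (suc n) + antidiagonal (flip (t ∘ suc)) n  ≈⟨ +-comm _ _ ⟩
    antidiagonal (flip (t ∘ suc)) n + t 0 (suc n)  ≈⟨ antidiagonal-last (flip t) n ⟨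
    antidiagonal (flip t) (suc n)                  ∎

  antidiagonal-+ : ∀ t t′ n → antidiagonal (λ i j → t i j + t′ i j) n ≈ antidiagonal t n + antidiagonal t′ n
  antidiagonal-+ t t′ zero    = refl
  antidiagonal-+ t t′ (suc n) = begin
    t 0 (suc n) + t′ 0 (suc n) + antidiagonal (λ i j → t (suc i) j + t′ (suc i) j) n
      ≈⟨ +-congˡ (antidiagonal-+ (t ∘ suc) (t′ ∘ suc) n) ⟩
    t 0 (suc n) + t′ 0 (suc n) + (antidiagonal (t ∘ suc) n + antidiagonal (t′ ∘ suc) n)
      ≈⟨ solve 4 (λ a b x y → a :+ b :+ (x :+ y) := a :+ x :+ (b :+ y)) refl _ _ _ _ ⟩
    t 0 (suc n) + antidiagonal (t ∘ suc) n + (t′ 0 (suc n) + antidiagonal (t′ ∘ suc) n) ∎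

  antidiagonal-*ˡ : ∀ x t n → x * antidiagonal t n ≈ antidiagonal (λ i j → x * t i j) n
  antidiagonal-*ˡ x t zero    = refl
  antidiagonal-*ˡ x t (suc n) = trans (distribˡ x _ _) (+-congˡ (antidiagonal-*ˡ x (t ∘ suc) n))

  -- `p i` is the i-th power of a base, and `D n` is an inverse of (p;p)_n. Supplying the inverses
  -- as data allows Gaussian binomials in a ring without division.
  module _
    (p : ℕ → Carrier) (p-0 : p 0 ≈ 1#) (p-+ : ∀ i j → p (i ℕ.+ j) ≈ p i * p j)
    (D : ℕ → Carrier) (∏-*-D : ∀ n → ∏ (λ i → 1# - p (suc i)) n * D n ≈ 1#)
    where

    [p]! : ℕ → Carrier
    [p]! = ∏ (λ i → 1# - p (suc i))

    -- Uniqueness of inverses: (1 - p^(n+1)) D (n+1) is a second inverse of (p;p)_n.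
    D-suc : ∀ n → D (suc n) - p (suc n) * D (suc n) ≈ D n
    D-suc n = begin
      D (suc n) - p (suc n) * D (suc n)                    ≈⟨ [1-x]*y≈y-x*y (p (suc n)) (D (suc n)) ⟨
      (1# - p (suc n)) * D (suc n)                         ≈⟨ *-identityˡ _ ⟨
      1# * ((1# - p (suc n)) * D (suc n))                  ≈⟨ *-congʳ (∏-*-D n) ⟨
      [p]! n * D n * ((1# - p (suc n)) * D (suc n))        ≈⟨ solve 4 (λ a b x y → a :* b :* (x :* y) := a :* x :* y :* b) refl _ _ _ _ ⟩
      [p]! (suc n) * D (suc n) * D n                       ≈⟨ *-congʳ (∏-*-D (suc n)) ⟩
      1# * D n                                             ≈⟨ *-identityˡ (D n) ⟩
      D n                                                  ∎

    D-0 : ∀ x → x - p 0 * x ≈ 0#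
    D-0 x = trans (+-congˡ (-‿cong (trans (*-congʳ p-0) (*-identityˡ x)))) (-‿inverseʳ x)

    binomialSum : (ℕ → Carrier) → ℕ → Carrier
    binomialSum W = antidiagonal (λ i j → W i * (D i * D j))

    -- With D i = 1/(p;p)_i, the identity (1 - p^(i+j)) D i D j = D i D (j-1) + p^j D (i-1) D j is
    -- Pascal's rule for the Gaussian binomial coefficients (p;p)_(i+j) D i D j.
    binomialSum-suc : ∀ W x n → (∀ i j → i ℕ.+ j ≡ n → x * W i ≈ - (p j * W (suc i))) →
      (1# - x) * binomialSum W n ≈ (1# - p (suc n)) * binomialSum W (suc n)
    binomialSum-suc W x n x*W = sym (begin
      (1# - p (suc n)) * binomialSum W (suc n)
        ≈⟨ antidiagonal-*ˡ _ (λ i j → W i * (D i * D j)) (suc n) ⟩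
      antidiagonal (λ i j → (1# - p (suc n)) * (W i * (D i * D j))) (suc n)
        ≈⟨ antidiagonal-cong (suc n) pascal ⟩
      antidiagonal (λ i j → t₁ i j + t₂ i j) (suc n)
        ≈⟨ antidiagonal-+ t₁ t₂ (suc n) ⟩
      antidiagonal t₁ (suc n) + antidiagonal t₂ (suc n)
        ≈⟨ +-congʳ (antidiagonal-last t₁ n) ⟩
      antidiagonal (λ i j → t₁ i (suc j)) n + t₁ (suc n) 0 + (t₂ 0 (suc n) + antidiagonal (t₂ ∘ suc) n)
        ≈⟨ +-cong (+-cong (antidiagonal-cong n t₁-suc) t₁-0) (+-cong t₂-0 (antidiagonal-cong n t₂-suc)) ⟩
      binomialSum W n + 0# + (0# + antidiagonal (λ i j → - x * (W i * (D i * D j))) n)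
        ≈⟨ +-cong (+-identityʳ _) (+-identityˡ _) ⟩
      binomialSum W n + antidiagonal (λ i j → - x * (W i * (D i * D j))) n
        ≈⟨ +-congˡ (antidiagonal-*ˡ (- x) (λ i j → W i * (D i * D j)) n) ⟨
      binomialSum W n + - x * binomialSum W n
        ≈⟨ +-congˡ (-‿distribˡ-* x _) ⟨
      binomialSum W n - x * binomialSum W n
        ≈⟨ [1-x]*y≈y-x*y x _ ⟨
      (1# - x) * binomialSum W n ∎)
      where
      -- `D j - p j * D j` stands for D (j-1), and likewise for `i`. At index 0 it is zero by `D-0`,
      -- as the boundary of Pascal's rule demands.
      t₁ t₂ : ℕ → ℕ → Carrier
      t₁ i j = W i * (D i * (D j - p j * D j))
      t₂ i j = p j * W i * ((D i - p i * D i) * D j)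

      pascal : ∀ i j → i ℕ.+ j ≡ suc n → (1# - p (suc n)) * (W i * (D i * D j)) ≈ t₁ i j + t₂ i j
      pascal i j i+j≡1+n = begin
        (1# - p (suc n)) * (W i * (D i * D j))
          ≈⟨ [1-x]*y≈y-x*y _ _ ⟩
        W i * (D i * D j) - p (suc n) * (W i * (D i * D j))
          ≈⟨ +-congˡ (-‿cong (*-congʳ (trans (reflexive (≡.cong p (≡.sym i+j≡1+n))) (p-+ i j)))) ⟩
        W i * (D i * D j) - p i * p j * (W i * (D i * D j))
          ≈⟨ solve 5 (λ w a b x y → w :* (a :* b) :- x :* y :* (w :* (a :* b)) :=
               w :* (a :* (b :- y :* b)) :+ y :* w :* ((a :- x :* a) :* b)) refl (W i) (D i) (D j) (p i) (p j) ⟩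
        t₁ i j + t₂ i j ∎

      t₁-0 : t₁ (suc n) 0 ≈ 0#
      t₁-0 = trans (*-congˡ (trans (*-congˡ (D-0 (D 0))) (zeroʳ _))) (zeroʳ _)

      t₂-0 : t₂ 0 (suc n) ≈ 0#
      t₂-0 = trans (*-congˡ (trans (*-congʳ (D-0 (D 0))) (zeroˡ _))) (zeroʳ _)

      t₁-suc : ∀ i j → i ℕ.+ j ≡ n → t₁ i (suc j) ≈ W i * (D i * D j)
      t₁-suc i j _ = *-congˡ (*-congˡ (D-suc j))

      t₂-suc : ∀ i j → i ℕ.+ j ≡ n → t₂ (suc i) j ≈ - x * (W i * (D i * D j))
      t₂-suc i j i+j≡n = begin
        p j * W (suc i) * ((D (suc i) - p (suc i) * D (suc i)) * D j)
          ≈⟨ *-congˡ (*-congʳ (D-suc i)) ⟩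
        p j * W (suc i) * (D i * D j)
          ≈⟨ solve 2 (λ y z → y :* z := :- (:- y) :* z) refl (p j * W (suc i)) (D i * D j) ⟩
        - (- (p j * W (suc i))) * (D i * D j)
          ≈⟨ *-congʳ (-‿cong (x*W i j i+j≡n)) ⟨
        - (x * W i) * (D i * D j)
          ≈⟨ solve 3 (λ x w z → :- (x :* w) :* z := :- x :* (w :* z)) refl x (W i) (D i * D j) ⟩
        - x * (W i * (D i * D j)) ∎

    -- Each new factor raises the level by one and leaves the weights `W` alone. The start at an
    -- arbitrary level `M` lets one family of factors be multiplied onto a sum that another family
    -- has already produced.
    binomialSum-product : ∀ W (x : ℕ → Carrier) M → (∀ N i j → i ℕ.+ j ≡ N ℕ.+ M → x N * W i ≈ - (p j * W (suc i))) →
      ∀ N → ∏ (λ i → 1# - x i) N * ([p]! M * binomialSum W M) ≈ [p]! (N ℕ.+ M) * binomialSum W (N ℕ.+ M)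
    binomialSum-product W x M x*W zero    = *-identityˡ _
    binomialSum-product W x M x*W (suc N) = begin
      ∏ (λ i → 1# - x i) N * (1# - x N) * ([p]! M * binomialSum W M)
        ≈⟨ solve 3 (λ a b c → a :* b :* c := b :* (a :* c)) refl _ _ _ ⟩
      (1# - x N) * (∏ (λ i → 1# - x i) N * ([p]! M * binomialSum W M))
        ≈⟨ *-congˡ (binomialSum-product W x M x*W N) ⟩
      (1# - x N) * ([p]! (N ℕ.+ M) * binomialSum W (N ℕ.+ M))
        ≈⟨ solve 3 (λ a b c → a :* (b :* c) := b :* (a :* c)) refl _ _ _ ⟩
      [p]! (N ℕ.+ M) * ((1# - x N) * binomialSum W (N ℕ.+ M))
        ≈⟨ *-congˡ (binomialSum-suc W (x N) (N ℕ.+ M) (x*W N)) ⟩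
      [p]! (N ℕ.+ M) * ((1# - p (suc N ℕ.+ M)) * binomialSum W (suc N ℕ.+ M))
        ≈⟨ *-assoc _ _ _ ⟨
      [p]! (suc N ℕ.+ M) * binomialSum W (suc N ℕ.+ M) ∎

    -- The model is `u i` = z p^i and `v j` = p^(j+1)/z. In the product `u i * v j` the variable z
    -- cancels, so neither z nor 1/z has to exist in the ring.
    module _
      (u v : ℕ → Carrier)
      (u-+ : ∀ i j → u (i ℕ.+ j) ≈ p j * u i)
      (v-+ : ∀ i j → v (i ℕ.+ j) ≈ p j * v i)
      (u*v : ∀ i j → u i * v j ≈ p (i ℕ.+ suc j))
      where

      U V : ℕ → Carrier
      U = signedPower u
      V = signedPower v

      -- The terms … V 2, V 1, U 0, U 1, U 2 … of the bilateral sum, listed from V M on.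
      bilateral : ℕ → ℕ → Carrier
      bilateral zero    i       = U i
      bilateral (suc M) zero    = V (suc M)
      bilateral (suc M) (suc i) = bilateral M i

      signedPower-step : ∀ w → (∀ i j → w (i ℕ.+ j) ≈ p j * w i) →
        ∀ {N} i j → i ℕ.+ j ≡ N → w N * signedPower w i ≈ - (p j * signedPower w (suc i))
      signedPower-step w w-+ i j ≡.refl = begin
        w (i ℕ.+ j) * signedPower w i       ≈⟨ *-congʳ (w-+ i j) ⟩
        p j * w i * signedPower w i         ≈⟨ solve 3 (λ a b c → a :* b :* c := :- (a :* (:- (b :* c)))) refl _ _ _ ⟩
        - (p j * signedPower w (suc i))     ∎

      bilateral-0 : ∀ M → bilateral M 0 ≈ V M
      bilateral-0 zero    = refl
      bilateral-0 (suc M) = refl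

      bilateral-V : ∀ M i j → i ℕ.+ j ≡ M → bilateral M i ≈ V j
      bilateral-V M       zero    j ≡.refl = bilateral-0 M
      bilateral-V (suc M) (suc i) j i+j≡M = bilateral-V M i j (ℕ.suc-injective i+j≡M)

      bilateral-U : ∀ M i j → i ≡ j ℕ.+ M → bilateral M i ≈ U j
      bilateral-U zero    i       j i≡j+M = reflexive (≡.cong U (≡.trans i≡j+M (ℕ.+-identityʳ j)))
      bilateral-U (suc M) zero    j i≡j+M with () ← ≡.trans i≡j+M (ℕ.+-suc j M)
      bilateral-U (suc M) (suc i) j i≡j+M = bilateral-U M i j (ℕ.suc-injective (≡.trans i≡j+M (ℕ.+-suc j M)))

      -- Among the `U` terms this is the shift rule for `u`. Among the `V` terms, one place towards
      -- the centre strips off a factor `v M`, and `u N` turns exactly that factor into a power of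
      -- the base.
      bilateral-step : ∀ M N i j → i ℕ.+ j ≡ N ℕ.+ M → u N * bilateral M i ≈ - (p j * bilateral M (suc i))
      bilateral-step zero N i j eq = signedPower-step u u-+ i j (≡.trans eq (ℕ.+-identityʳ N))
      bilateral-step (suc M) N zero j ≡.refl = begin
        u N * (- (v M * V M))                    ≈⟨ solve 3 (λ a b c → a :* (:- (b :* c)) := :- (a :* b :* c)) refl _ _ _ ⟩
        - (u N * v M * V M)                      ≈⟨ -‿cong (*-cong (u*v N M) (sym (bilateral-0 M))) ⟩
        - (p (N ℕ.+ suc M) * bilateral M 0)      ∎
      bilateral-step (suc M) N (suc i) j eq =
        bilateral-step M N i j (ℕ.suc-injective (≡.trans eq (ℕ.+-suc N M)))

      -- The factors in `v` build a sum with weights V 0, ..., V M. Read backwards it carries the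
      -- first weights of `bilateral M`, whose recurrence then admits the factors in `u`.
      finiteTripleProduct : ∀ N M →
        ∏ (λ i → 1# - u i) N * ∏ (λ i → 1# - v i) M ≈ [p]! (N ℕ.+ M) * binomialSum (bilateral M) (N ℕ.+ M)
      finiteTripleProduct N M = begin
        ∏ (λ i → 1# - u i) N * ∏ (λ i → 1# - v i) M
          ≈⟨ *-congˡ expand-v ⟩
        ∏ (λ i → 1# - u i) N * ([p]! M * binomialSum (bilateral M) M)
          ≈⟨ binomialSum-product (bilateral M) u M (bilateral-step M) N ⟩
        [p]! (N ℕ.+ M) * binomialSum (bilateral M) (N ℕ.+ M) ∎
        where
        unit : [p]! 0 * binomialSum V 0 ≈ 1#
        unit = begin
          1# * (1# * (D 0 * D 0))  ≈⟨ trans (*-identityˡ _) (*-identityˡ _) ⟩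
          D 0 * D 0                ≈⟨ *-cong D-0≈1 D-0≈1 ⟩
          1# * 1#                  ≈⟨ *-identityˡ 1# ⟩
          1#                       ∎
          where
          D-0≈1 : D 0 ≈ 1#
          D-0≈1 = trans (sym (*-identityˡ (D 0))) (∏-*-D 0)

        expand-v : ∏ (λ i → 1# - v i) M ≈ [p]! M * binomialSum (bilateral M) M
        expand-v = begin
          ∏ (λ i → 1# - v i) M
            ≈⟨ *-identityʳ _ ⟨
          ∏ (λ i → 1# - v i) M * 1#
            ≈⟨ *-congˡ unit ⟨
          ∏ (λ i → 1# - v i) M * ([p]! 0 * binomialSum V 0)
            ≈⟨ binomialSum-product V v 0 (λ L i j eq → signedPower-step v v-+ i j (≡.trans eq (ℕ.+-identityʳ L))) M ⟩
          [p]! (M ℕ.+ 0) * binomialSum V (M ℕ.+ 0)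
            ≡⟨ ≡.cong (λ L → [p]! L * binomialSum V L) (ℕ.+-identityʳ M) ⟩
          [p]! M * binomialSum V M
            -- Gaussian binomials are symmetric in their two indices, so reversing the sum affects
            -- only the weights.
            ≈⟨ *-congˡ (antidiagonal-flip (λ i j → V i * (D i * D j)) M) ⟩
          [p]! M * antidiagonal (λ i j → V j * (D j * D i)) M
            ≈⟨ *-congˡ (antidiagonal-cong M λ i j i+j≡M → *-cong (sym (bilateral-V M i j i+j≡M)) (*-comm (D j) (D i))) ⟩
          [p]! M * binomialSum (bilateral M) M ∎

      symmetricSum-bilateral : ∀ N → antidiagonal (λ i _ → bilateral N i) (N ℕ.+ N) ≈ symmetricSum u v N
      symmetricSum-bilateral zero    = refl
      symmetricSum-bilateral (suc N) = begin
        V (suc N) + antidiagonal (λ i _ → bilateral N i) (N ℕ.+ suc N)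
          ≡⟨ ≡.cong (λ L → V (suc N) + antidiagonal (λ i _ → bilateral N i) L) (ℕ.+-suc N N) ⟩
        V (suc N) + antidiagonal (λ i _ → bilateral N i) (suc (N ℕ.+ N))
          ≈⟨ +-congˡ (antidiagonal-last (λ i _ → bilateral N i) (N ℕ.+ N)) ⟩
        V (suc N) + (antidiagonal (λ i _ → bilateral N i) (N ℕ.+ N) + bilateral N (suc N ℕ.+ N))
          ≈⟨ +-congˡ (+-cong (symmetricSum-bilateral N) (bilateral-U N _ (suc N) ≡.refl)) ⟩
        V (suc N) + (symmetricSum u v N + U (suc N))
          ≈⟨ solve 3 (λ a b c → a :+ (b :+ c) := b :+ (c :+ a)) refl _ _ _ ⟩
        symmetricSum u v N + (U (suc N) + V (suc N)) ∎

      -- Multiplied by (p;p)_N, the Gaussian binomial of `i` and `j` becomes 1 as soon as both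
      -- indices reach `K`, by stability of (p;p)_n. If one index is below `K`, the term lies at
      -- least N - K places from the centre; this is at least `K` because N ≥ 2K, so the theta term
      -- is itself zero and its coefficient is irrelevant.
      tripleProduct : ∀ K →
        (∀ {n} → K ℕ.≤ n → [p]! n ≈ [p]! K) → (∀ {m} → K ℕ.≤ m → U m ≈ 0#) → (∀ {m} → K ℕ.≤ m → V m ≈ 0#) →
        ∀ {N} → K ℕ.+ K ℕ.≤ N → ∏ (λ i → 1# - u i) N * ∏ (λ i → 1# - v i) N * [p]! N ≈ symmetricSum u v N
      tripleProduct K [p]!-stable U-vanishes V-vanishes {N} 2K≤N = begin
        ∏ (λ i → 1# - u i) N * ∏ (λ i → 1# - v i) N * [p]! N
          ≈⟨ *-congʳ (finiteTripleProduct N N) ⟩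
        [p]! (N ℕ.+ N) * binomialSum (bilateral N) (N ℕ.+ N) * [p]! N
          ≈⟨ solve 3 (λ a b c → a :* b :* c := a :* c :* b) refl _ _ _ ⟩
        [p]! (N ℕ.+ N) * [p]! N * binomialSum (bilateral N) (N ℕ.+ N)
          ≈⟨ *-congʳ (*-cong ([p]!-stable (ℕ.≤-trans K≤N (ℕ.m≤m+n N N))) ([p]!-stable K≤N)) ⟩
        [p]! K * [p]! K * binomialSum (bilateral N) (N ℕ.+ N)
          ≈⟨ antidiagonal-*ˡ _ (λ i j → bilateral N i * (D i * D j)) (N ℕ.+ N) ⟩
        antidiagonal (λ i j → [p]! K * [p]! K * (bilateral N i * (D i * D j))) (N ℕ.+ N)
          ≈⟨ antidiagonal-cong (N ℕ.+ N) (λ i j i+j≡2N → term i j i+j≡2N (K ℕ.≤? i) (K ℕ.≤? j)) ⟩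
        antidiagonal (λ i _ → bilateral N i) (N ℕ.+ N)
          ≈⟨ symmetricSum-bilateral N ⟩
        symmetricSum u v N ∎
        where
        K≤N : K ℕ.≤ N
        K≤N = ℕ.m+n≤o⇒m≤o K 2K≤N

        K≤N∸ : ∀ {i} → i ℕ.< K → K ℕ.≤ N ℕ.∸ i
        K≤N∸ {i} i<K = ℕ.m+n≤o⇒m≤o∸n K (ℕ.≤-trans (ℕ.+-monoʳ-≤ K (ℕ.<⇒≤ i<K)) 2K≤N)

        vanish : ∀ {w} x y → w ≈ 0# → x * (w * y) ≈ w
        vanish {w} x y w≈0 = begin
          x * (w * y)   ≈⟨ *-congˡ (*-congʳ w≈0) ⟩
          x * (0# * y)  ≈⟨ *-congˡ (zeroˡ y) ⟩
          x * 0#        ≈⟨ zeroʳ x ⟩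
          0#            ≈⟨ w≈0 ⟨
          w             ∎

        term : ∀ i j → i ℕ.+ j ≡ N ℕ.+ N → Dec (K ℕ.≤ i) → Dec (K ℕ.≤ j) →
          [p]! K * [p]! K * (bilateral N i * (D i * D j)) ≈ bilateral N i
        term i j _ (yes K≤i) (yes K≤j) = begin
          [p]! K * [p]! K * (bilateral N i * (D i * D j))
            ≈⟨ *-congʳ (*-cong ([p]!-stable K≤i) ([p]!-stable K≤j)) ⟨
          [p]! i * [p]! j * (bilateral N i * (D i * D j))
            ≈⟨ solve 5 (λ a b w x y → a :* b :* (w :* (x :* y)) := a :* x :* (b :* y :* w)) refl _ _ _ _ _ ⟩
          [p]! i * D i * ([p]! j * D j * bilateral N i)
            ≈⟨ *-cong (∏-*-D i) (*-congʳ (∏-*-D j)) ⟩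
          1# * (1# * bilateral N i)
            ≈⟨ trans (*-identityˡ _) (*-identityˡ _) ⟩
          bilateral N i ∎
        term i j _ (no K≰i) _ = vanish _ _ (trans
          (bilateral-V N i (N ℕ.∸ i) (ℕ.m+[n∸m]≡n (ℕ.≤-trans (ℕ.<⇒≤ i<K) K≤N)))
          (V-vanishes (K≤N∸ i<K)))
          where i<K = ℕ.≰⇒> K≰i
        term i j i+j≡2N (yes _) (no K≰j) = vanish _ _ (trans
          (bilateral-U N i (N ℕ.∸ j) i≡N∸j+N)
          (U-vanishes (K≤N∸ j<K)))
          where
          j<K = ℕ.≰⇒> K≰j
          i≡N∸j+N : i ≡ N ℕ.∸ j ℕ.+ N
          i≡N∸j+N = ≡.trans (≡.sym (ℕ.m+n∸n≡m i j)) (≡.trans (≡.cong (ℕ._∸ j) i+j≡2N)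
            (ℕ.+-∸-comm N (ℕ.≤-trans (ℕ.<⇒≤ j<K) K≤N)))

-- Arithmetic of power series

open import Defs
open import Data.Integer.Base using (ℤ; 0ℤ; 1ℤ; _+_; _*_; -_; _<_; _>_; _≤_; +≤+; +<+; nonNegative)
open import Relation.Binary.PropositionalEquality using (_≗_; refl; sym; trans; cong; cong₂; subst; module ≡-Reasoning)

infixl 6 _⊕_
infix 8 ⊝_

0ₛ : PowerSeries
0ₛ _ = 0ℤ

constant : ℤ → PowerSeries
constant c zero    = c
constant c (suc _) = 0ℤ

_⊕_ : PowerSeries → PowerSeries → PowerSeries
(p ⊕ r) n = p n + r n

⊝_ : PowerSeries → PowerSeries
(⊝ p) n = - p n

1ₛ≗constant : 1ₛ ≗ constant 1ℤ
1ₛ≗constant zero    = refl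
1ₛ≗constant (suc _) = refl

⊛-cong-≤ : ∀ {p p′ r r′} n → (∀ {k} → k ℕ.≤ n → p k ≡ p′ k) → (∀ {k} → k ℕ.≤ n → r k ≡ r′ k) →
           (p ⊛ r) n ≡ (p′ ⊛ r′) n
⊛-cong-≤ zero    p≡ r≡ = cong (_+ 0ℤ) (cong₂ _*_ (p≡ z≤n) (r≡ z≤n))
⊛-cong-≤ (suc n) p≡ r≡ = cong₂ _+_ (cong₂ _*_ (p≡ z≤n) (r≡ ℕ.≤-refl))
  (⊛-cong-≤ n (p≡ ∘ s≤s) (r≡ ∘ ℕ.m≤n⇒m≤1+n))

-- `⊛` unfolds definitionally by shifting its left factor; commutativity must also peel it from the
-- right.
⊛-unfold-last : ∀ p r n → (p ⊛ r) (suc n) ≡ (p ⊛ (r ∘ suc)) n + p (suc n) * r 0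
⊛-unfold-last p r zero = lemma (p 0) (p 1) (r 0) (r 1)
  where
  lemma : ∀ a b c d → a * d + (b * c + 0ℤ) ≡ a * d + 0ℤ + b * c
  lemma = ℤ.solve-∀
⊛-unfold-last p r (suc n) = begin
  p 0 * r (2 ℕ.+ n) + (p ∘ suc ⊛ r) (suc n)
    ≡⟨ cong (p 0 * r (2 ℕ.+ n) +_) (⊛-unfold-last (p ∘ suc) r n) ⟩
  p 0 * r (2 ℕ.+ n) + ((p ∘ suc ⊛ r ∘ suc) n + p (2 ℕ.+ n) * r 0)
    ≡⟨ ℤ.+-assoc (p 0 * r (2 ℕ.+ n)) _ _ ⟨
  (p ⊛ (r ∘ suc)) (suc n) + p (2 ℕ.+ n) * r 0 ∎
  where open ≡-Reasoning

⊛-comm : ∀ p r → p ⊛ r ≗ r ⊛ p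
⊛-comm p r zero    = cong (_+ 0ℤ) (ℤ.*-comm (p 0) (r 0))
⊛-comm p r (suc n) = begin
  p 0 * r (suc n) + (p ∘ suc ⊛ r) n    ≡⟨ cong₂ _+_ (ℤ.*-comm (p 0) (r (suc n))) (⊛-comm (p ∘ suc) r n) ⟩
  r (suc n) * p 0 + (r ⊛ (p ∘ suc)) n  ≡⟨ ℤ.+-comm (r (suc n) * p 0) _ ⟩
  (r ⊛ (p ∘ suc)) n + r (suc n) * p 0  ≡⟨ ⊛-unfold-last r p n ⟨
  (r ⊛ p) (suc n)                      ∎
  where open ≡-Reasoning

⊛-zeroˡ : ∀ r → 0ₛ ⊛ r ≗ 0ₛ
⊛-zeroˡ r zero    = refl
⊛-zeroˡ r (suc n) = trans (ℤ.+-identityˡ _) (⊛-zeroˡ r n)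

constant-⊛ : ∀ c r n → (constant c ⊛ r) n ≡ c * r n
constant-⊛ c r zero    = ℤ.+-identityʳ (c * r 0)
constant-⊛ c r (suc n) = trans (cong (c * r (suc n) +_) (⊛-zeroˡ r n)) (ℤ.+-identityʳ (c * r (suc n)))

⊛-identityˡ : ∀ p → 1ₛ ⊛ p ≗ p
⊛-identityˡ p n = begin
  (1ₛ ⊛ p) n          ≡⟨ ⊛-cong-≤ {r = p} n (λ {k} _ → 1ₛ≗constant k) (λ _ → refl) ⟩
  (constant 1ℤ ⊛ p) n ≡⟨ constant-⊛ 1ℤ p n ⟩
  1ℤ * p n            ≡⟨ ℤ.*-identityˡ (p n) ⟩
  p n                 ∎
  where open ≡-Reasoning

⊛-distribʳ-⊕ : ∀ r p s → (p ⊕ s) ⊛ r ≗ (p ⊛ r) ⊕ (s ⊛ r)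
⊛-distribʳ-⊕ r p s zero = lemma (p 0) (s 0) (r 0)
  where
  lemma : ∀ a b c → (a + b) * c + 0ℤ ≡ a * c + 0ℤ + (b * c + 0ℤ)
  lemma = ℤ.solve-∀
⊛-distribʳ-⊕ r p s (suc n) =
  trans (cong ((p 0 + s 0) * r (suc n) +_) (⊛-distribʳ-⊕ r (p ∘ suc) (s ∘ suc) n))
        (lemma (p 0) (s 0) (r (suc n)) ((p ∘ suc ⊛ r) n) ((s ∘ suc ⊛ r) n))
  where
  lemma : ∀ a b c x y → (a + b) * c + (x + y) ≡ a * c + x + (b * c + y)
  lemma = ℤ.solve-∀

⊛-scaleˡ : ∀ c p r n → ((λ k → c * p k) ⊛ r) n ≡ c * (p ⊛ r) n
⊛-scaleˡ c p r zero = lemma c (p 0) (r 0)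
  where
  lemma : ∀ a b c → a * b * c + 0ℤ ≡ a * (b * c + 0ℤ)
  lemma = ℤ.solve-∀
⊛-scaleˡ c p r (suc n) = trans (cong (c * p 0 * r (suc n) +_) (⊛-scaleˡ c (p ∘ suc) r n))
  (lemma c (p 0) (r (suc n)) ((p ∘ suc ⊛ r) n))
  where
  lemma : ∀ a b c x → a * b * c + a * x ≡ a * (b * c + x)
  lemma = ℤ.solve-∀

⊛-assoc : ∀ p r s → p ⊛ r ⊛ s ≗ p ⊛ (r ⊛ s)
⊛-assoc p r s zero = lemma (p 0) (r 0) (s 0)
  where
  lemma : ∀ a b c → (a * b + 0ℤ) * c + 0ℤ ≡ a * (b * c + 0ℤ) + 0ℤ
  lemma = ℤ.solve-∀
⊛-assoc p r s (suc n) = begin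
  (p 0 * r 0 + 0ℤ) * s (suc n) + (((λ k → p 0 * r (suc k)) ⊕ (p ∘ suc ⊛ r)) ⊛ s) n
    ≡⟨ cong ((p 0 * r 0 + 0ℤ) * s (suc n) +_) (⊛-distribʳ-⊕ s (λ k → p 0 * r (suc k)) (p ∘ suc ⊛ r) n) ⟩
  (p 0 * r 0 + 0ℤ) * s (suc n) + (((λ k → p 0 * r (suc k)) ⊛ s) n + (p ∘ suc ⊛ r ⊛ s) n)
    ≡⟨ cong ((p 0 * r 0 + 0ℤ) * s (suc n) +_) (cong₂ _+_ (⊛-scaleˡ (p 0) (r ∘ suc) s n) (⊛-assoc (p ∘ suc) r s n)) ⟩
  (p 0 * r 0 + 0ℤ) * s (suc n) + (p 0 * (r ∘ suc ⊛ s) n + (p ∘ suc ⊛ (r ⊛ s)) n)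
    ≡⟨ lemma (p 0) (r 0) (s (suc n)) ((r ∘ suc ⊛ s) n) _ ⟩
  p 0 * (r 0 * s (suc n) + (r ∘ suc ⊛ s) n) + (p ∘ suc ⊛ (r ⊛ s)) n ∎
  where
  open ≡-Reasoning
  lemma : ∀ a b c x y → (a * b + 0ℤ) * c + (a * x + y) ≡ a * (b * c + x) + y
  lemma = ℤ.solve-∀

-- The two sides are not definitionally equal, because ⌊_⌋ inspects the decision itself.
q^-suc : ∀ a n → (q^ suc a) (suc n) ≡ (q^ a) n
q^-suc a n = cong (λ b → if b then 1ℤ else 0ℤ) (trans (isYes≗does (suc n ℕ.≟ suc a)) (sym (isYes≗does (n ℕ.≟ a))))

q^-⊛-suc : ∀ a r n → (q^ suc a ⊛ r) (suc n) ≡ (q^ a ⊛ r) n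
q^-⊛-suc a r n = trans (ℤ.+-identityˡ (((q^ suc a) ∘ suc ⊛ r) n)) (⊛-cong-≤ {r = r} n (λ {k} _ → q^-suc a k) (λ _ → refl))

q^-⊛-+ : ∀ a r n → (q^ a ⊛ r) (a ℕ.+ n) ≡ r n
q^-⊛-+ zero    r n = ⊛-identityˡ r n
q^-⊛-+ (suc a) r n = trans (q^-⊛-suc a r (a ℕ.+ n)) (q^-⊛-+ a r n)

q^-⊛-< : ∀ a r {n} → n ℕ.< a → (q^ a ⊛ r) n ≡ 0ℤ
q^-⊛-< (suc a) r {zero}  _         = refl
q^-⊛-< (suc a) r {suc n} (s≤s n<a) = trans (q^-⊛-suc a r n) (q^-⊛-< a r n<a)

q^-homo-+ : ∀ a b → q^ (a ℕ.+ b) ≗ q^ a ⊛ q^ b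
q^-homo-+ zero    b n       = sym (⊛-identityˡ (q^ b) n)
q^-homo-+ (suc a) b zero    = refl
q^-homo-+ (suc a) b (suc n) = begin
  (q^ suc (a ℕ.+ b)) (suc n) ≡⟨ q^-suc (a ℕ.+ b) n ⟩
  (q^ (a ℕ.+ b)) n           ≡⟨ q^-homo-+ a b n ⟩
  (q^ a ⊛ q^ b) n            ≡⟨ q^-⊛-suc a (q^ b) n ⟨
  (q^ suc a ⊛ q^ b) (suc n)  ∎
  where open ≡-Reasoning

-- The substitution of q⁵ for q

expand₅ : PowerSeries → PowerSeries
expand₅ p 0 = p 0
expand₅ p 1 = 0ℤ
expand₅ p 2 = 0ℤ
expand₅ p 3 = 0ℤ
expand₅ p 4 = 0ℤ
expand₅ p (suc (suc (suc (suc (suc n))))) = expand₅ (p ∘ suc) n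

expand₅-*5 : ∀ p n → expand₅ p (n ℕ.* 5) ≡ p n
expand₅-*5 p zero    = refl
expand₅-*5 p (suc n) = expand₅-*5 (p ∘ suc) n

expand₅-off : ∀ p t n → t ℕ.< 4 → expand₅ p (suc t ℕ.+ n ℕ.* 5) ≡ 0ℤ
expand₅-off p 0 zero    _ = refl
expand₅-off p 1 zero    _ = refl
expand₅-off p 2 zero    _ = refl
expand₅-off p 3 zero    _ = refl
expand₅-off p 0 (suc n) h = expand₅-off (p ∘ suc) 0 n h
expand₅-off p 1 (suc n) h = expand₅-off (p ∘ suc) 1 n h
expand₅-off p 2 (suc n) h = expand₅-off (p ∘ suc) 2 n h
expand₅-off p 3 (suc n) h = expand₅-off (p ∘ suc) 3 n h
expand₅-off p (suc (suc (suc (suc t)))) n (s≤s (s≤s (s≤s (s≤s ()))))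

q^-⊛-expand₅-on : ∀ s p n → (q^ s ⊛ expand₅ p) (s ℕ.+ n ℕ.* 5) ≡ p n
q^-⊛-expand₅-on s p n = trans (q^-⊛-+ s (expand₅ p) (n ℕ.* 5)) (expand₅-*5 p n)

q^-⊛-expand₅-above : ∀ s p t n → t ℕ.< 4 → (q^ s ⊛ expand₅ p) (s ℕ.+ (suc t ℕ.+ n ℕ.* 5)) ≡ 0ℤ
q^-⊛-expand₅-above s p t n t<4 = trans (q^-⊛-+ s (expand₅ p) (suc t ℕ.+ n ℕ.* 5)) (expand₅-off p t n t<4)

-- A residue `r` smaller than the shift `s` is met again one period later as the offset `suc t`
-- above `s`, which is the equation assumed. For n = 0 the index lies below the order of the series.
q^-⊛-expand₅-below : ∀ s p r t n → r ℕ.< s → s ℕ.+ suc t ≡ r ℕ.+ 5 → t ℕ.< 4 →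
  (q^ s ⊛ expand₅ p) (r ℕ.+ n ℕ.* 5) ≡ 0ℤ
q^-⊛-expand₅-below s p r t zero    r<s _  _   =
  q^-⊛-< s (expand₅ p) (ℕ.≤-<-trans (ℕ.≤-reflexive (ℕ.+-identityʳ r)) r<s)
q^-⊛-expand₅-below s p r t (suc n) _   eq t<4 = trans (cong (q^ s ⊛ expand₅ p) index) (q^-⊛-expand₅-above s p t n t<4)
  where
  index : r ℕ.+ (5 ℕ.+ n ℕ.* 5) ≡ s ℕ.+ (suc t ℕ.+ n ℕ.* 5)
  index = trans (sym (ℕ.+-assoc r 5 (n ℕ.* 5))) (trans (cong (ℕ._+ n ℕ.* 5) (sym eq)) (ℕ.+-assoc s (suc t) (n ℕ.* 5)))

expand₅-cong-≤ : ∀ {p r} n → (∀ {k} → k ℕ.≤ n → p k ≡ r k) → expand₅ p n ≡ expand₅ r n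
expand₅-cong-≤ 0 p≡r = p≡r z≤n
expand₅-cong-≤ 1 p≡r = refl
expand₅-cong-≤ 2 p≡r = refl
expand₅-cong-≤ 3 p≡r = refl
expand₅-cong-≤ 4 p≡r = refl
expand₅-cong-≤ (suc (suc (suc (suc (suc n))))) p≡r =
  expand₅-cong-≤ n λ k≤n → p≡r (ℕ.≤-trans (s≤s k≤n) (s≤s (ℕ.m≤n+m n 4)))

expand₅-⊕ : ∀ p r → expand₅ (p ⊕ r) ≗ expand₅ p ⊕ expand₅ r
expand₅-⊕ p r 0 = refl
expand₅-⊕ p r 1 = refl
expand₅-⊕ p r 2 = refl
expand₅-⊕ p r 3 = refl
expand₅-⊕ p r 4 = refl
expand₅-⊕ p r (suc (suc (suc (suc (suc n))))) = expand₅-⊕ (p ∘ suc) (r ∘ suc) n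

expand₅-⊝ : ∀ p → expand₅ (⊝ p) ≗ ⊝ expand₅ p
expand₅-⊝ p 0 = refl
expand₅-⊝ p 1 = refl
expand₅-⊝ p 2 = refl
expand₅-⊝ p 3 = refl
expand₅-⊝ p 4 = refl
expand₅-⊝ p (suc (suc (suc (suc (suc n))))) = expand₅-⊝ (p ∘ suc) n

expand₅-scale : ∀ c p → expand₅ (λ k → c * p k) ≗ (λ k → c * expand₅ p k)
expand₅-scale c p 0 = refl
expand₅-scale c p 1 = sym (ℤ.*-zeroʳ c)
expand₅-scale c p 2 = sym (ℤ.*-zeroʳ c)
expand₅-scale c p 3 = sym (ℤ.*-zeroʳ c)
expand₅-scale c p 4 = sym (ℤ.*-zeroʳ c)
expand₅-scale c p (suc (suc (suc (suc (suc n))))) = expand₅-scale c (p ∘ suc) n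

expand₅-q^ : ∀ e → expand₅ (q^ e) ≗ q^ (e ℕ.* 5)
expand₅-q^ zero    0 = refl
expand₅-q^ zero    1 = refl
expand₅-q^ zero    2 = refl
expand₅-q^ zero    3 = refl
expand₅-q^ zero    4 = refl
expand₅-q^ zero    (suc (suc (suc (suc (suc n))))) = expand₅-0ₛ n
  where
  expand₅-0ₛ : expand₅ 0ₛ ≗ 0ₛ
  expand₅-0ₛ 0 = refl
  expand₅-0ₛ 1 = refl
  expand₅-0ₛ 2 = refl
  expand₅-0ₛ 3 = refl
  expand₅-0ₛ 4 = refl
  expand₅-0ₛ (suc (suc (suc (suc (suc n))))) = expand₅-0ₛ n
expand₅-q^ (suc e) 0 = refl
expand₅-q^ (suc e) 1 = refl
expand₅-q^ (suc e) 2 = refl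
expand₅-q^ (suc e) 3 = refl
expand₅-q^ (suc e) 4 = refl
expand₅-q^ (suc e) (suc (suc (suc (suc (suc n))))) = begin
  expand₅ ((q^ suc e) ∘ suc) n                ≡⟨ expand₅-cong-≤ n (λ {k} _ → q^-suc e k) ⟩
  expand₅ (q^ e) n                            ≡⟨ expand₅-q^ e n ⟩
  (q^ (e ℕ.* 5)) n                            ≡⟨ q^-suc (e ℕ.* 5) n ⟨
  (q^ (1 ℕ.+ e ℕ.* 5)) (1 ℕ.+ n)              ≡⟨ q^-suc (1 ℕ.+ e ℕ.* 5) (1 ℕ.+ n) ⟨
  (q^ (2 ℕ.+ e ℕ.* 5)) (2 ℕ.+ n)              ≡⟨ q^-suc (2 ℕ.+ e ℕ.* 5) (2 ℕ.+ n) ⟨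
  (q^ (3 ℕ.+ e ℕ.* 5)) (3 ℕ.+ n)              ≡⟨ q^-suc (3 ℕ.+ e ℕ.* 5) (3 ℕ.+ n) ⟨
  (q^ (4 ℕ.+ e ℕ.* 5)) (4 ℕ.+ n)              ≡⟨ q^-suc (4 ℕ.+ e ℕ.* 5) (4 ℕ.+ n) ⟨
  (q^ (suc e ℕ.* 5)) (5 ℕ.+ n)                ∎
  where open ≡-Reasoning

expand₅-⊛ : ∀ p r → expand₅ (p ⊛ r) ≗ expand₅ p ⊛ expand₅ r
expand₅-⊛ p r 0 = refl
expand₅-⊛ p r 1 rewrite ℤ.*-zeroʳ (p 0) = refl
expand₅-⊛ p r 2 rewrite ℤ.*-zeroʳ (p 0) = refl
expand₅-⊛ p r 3 rewrite ℤ.*-zeroʳ (p 0) = refl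
expand₅-⊛ p r 4 rewrite ℤ.*-zeroʳ (p 0) = refl
expand₅-⊛ p r (suc (suc (suc (suc (suc n))))) = begin
  expand₅ ((λ k → p 0 * r (suc k)) ⊕ (p ∘ suc ⊛ r)) n
    ≡⟨ expand₅-⊕ (λ k → p 0 * r (suc k)) (p ∘ suc ⊛ r) n ⟩
  expand₅ (λ k → p 0 * r (suc k)) n + expand₅ (p ∘ suc ⊛ r) n
    ≡⟨ cong₂ _+_ (expand₅-scale (p 0) (r ∘ suc) n) (expand₅-⊛ (p ∘ suc) r n) ⟩
  p 0 * expand₅ (r ∘ suc) n + (expand₅ (p ∘ suc) ⊛ expand₅ r) n
    ≡⟨ cong (p 0 * expand₅ (r ∘ suc) n +_) (lemma _) ⟨
  (expand₅ p ⊛ expand₅ r) (5 ℕ.+ n) ∎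
  where
  open ≡-Reasoning
  lemma : ∀ x → 0ℤ + (0ℤ + (0ℤ + (0ℤ + x))) ≡ x
  lemma = ℤ.solve-∀

-- Series modulo q^(K+1)

-- As a record type, the congruence lets both series be inferred from it; a bare function type would
-- only show their values.
record _≈[_]_ (p : PowerSeries) (K : ℕ) (r : PowerSeries) : Set where
  constructor coefficientwise
  field coefficient : ∀ {k} → k ℕ.≤ K → p k ≡ r k
open _≈[_]_ public

≗⇒≈ : ∀ {p r K} → p ≗ r → p ≈[ K ] r
≗⇒≈ p≗r = coefficientwise λ {k} _ → p≗r k

infixl 7 _·_

-- Convolution sealed off, so that unification treats products as neutral.
opaque
  _·_ : PowerSeries → PowerSeries → PowerSeries
  _·_ = _⊛_

  ·≡⊛ : ∀ p r → p · r ≡ p ⊛ r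
  ·≡⊛ p r = refl

  ·-isCommutativeRing : ∀ K → IsCommutativeRing _≈[ K ]_ _⊕_ _·_ ⊝_ 0ₛ 1ₛ
  ·-isCommutativeRing K = record
      { isRing = record
        { +-isAbelianGroup = record
          { isGroup = record
            { isMonoid = record
              { isSemigroup = record
                { isMagma = record
                  { isEquivalence = record
                    { refl = coefficientwise λ _ → refl
                    ; sym = λ e → coefficientwise (sym ∘ coefficient e)
                    ; trans = λ e e′ → coefficientwise λ k≤K → trans (coefficient e k≤K) (coefficient e′ k≤K)
                    }
                  ; ∙-cong = λ e e′ → coefficientwise λ k≤K → cong₂ _+_ (coefficient e k≤K) (coefficient e′ k≤K)
                  }
                ; assoc = λ p r s → ≗⇒≈ λ k → ℤ.+-assoc (p k) (r k) (s k)
                }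
              ; identity = (λ p → ≗⇒≈ λ k → ℤ.+-identityˡ (p k)) , (λ p → ≗⇒≈ λ k → ℤ.+-identityʳ (p k))
              }
            ; inverse = (λ p → ≗⇒≈ λ k → ℤ.+-inverseˡ (p k)) , (λ p → ≗⇒≈ λ k → ℤ.+-inverseʳ (p k))
            ; ⁻¹-cong = λ e → coefficientwise λ k≤K → cong -_ (coefficient e k≤K)
            }
          ; comm = λ p r → ≗⇒≈ λ k → ℤ.+-comm (p k) (r k)
          }
        ; *-cong = λ {p} {p′} {r} {r′} e e′ → coefficientwise λ {k} k≤K → ⊛-cong-≤ {p} {p′} {r} {r′} k
            (λ i≤k → coefficient e (ℕ.≤-trans i≤k k≤K)) (λ i≤k → coefficient e′ (ℕ.≤-trans i≤k k≤K))
        ; *-assoc = λ p r s → ≗⇒≈ (⊛-assoc p r s)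
        ; *-identity = (λ p → ≗⇒≈ (⊛-identityˡ p)) , (λ p → ≗⇒≈ λ k → trans (⊛-comm p 1ₛ k) (⊛-identityˡ p k))
        ; distrib = (λ p r s → ≗⇒≈ (distribˡ p r s)) , (λ p r s → ≗⇒≈ (⊛-distribʳ-⊕ p r s))
        }
      ; *-comm = λ p r → ≗⇒≈ (⊛-comm p r)
      }
    where
    distribˡ : ∀ p r s → p ⊛ (r ⊕ s) ≗ (p ⊛ r) ⊕ (p ⊛ s)
    distribˡ p r s k = begin
      (p ⊛ (r ⊕ s)) k         ≡⟨ ⊛-comm p (r ⊕ s) k ⟩
      ((r ⊕ s) ⊛ p) k         ≡⟨ ⊛-distribʳ-⊕ p r s k ⟩
      (r ⊛ p) k + (s ⊛ p) k   ≡⟨ cong₂ _+_ (⊛-comm r p k) (⊛-comm s p k) ⟩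
      (p ⊛ r) k + (p ⊛ s) k   ∎
      where open ≡-Reasoning

truncatedSeries : ℕ → CommutativeRing _ _
truncatedSeries K = record { isCommutativeRing = ·-isCommutativeRing K }

·-coefficient : ∀ p r n → (p · r) n ≡ (p ⊛ r) n
·-coefficient p r n = cong (λ s → s n) (·≡⊛ p r)

·-recip : ∀ p → p 0 ≡ 1ℤ → p · recip p ≗ 1ₛ
·-recip p p₀≡1 n = trans (·-coefficient p (recip p) n) (⊛-recip p p₀≡1 n)

constant-homomorphism : ∀ K →
  CommutativeRing.rawRing ℤ.+-*-commutativeRing -Raw-AlmostCommutative⟶ fromCommutativeRing (truncatedSeries K)
constant-homomorphism K = record
  { ⟦_⟧    = constant
  ; +-homo = λ c d → ≗⇒≈ λ { zero → refl ; (suc _) → refl }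
  ; *-homo = λ c d → ≗⇒≈ λ k → trans (*-homo c d k) (sym (trans (·-coefficient (constant c) (constant d) k) (constant-⊛ c (constant d) k)))
  ; -‿homo = λ c → ≗⇒≈ λ { zero → refl ; (suc _) → refl }
  ; 0-homo = ≗⇒≈ λ { zero → refl ; (suc _) → refl }
  ; 1-homo = ≗⇒≈ (sym ∘ 1ₛ≗constant)
  }
  where
  *-homo : ∀ c d k → constant (c * d) k ≡ c * constant d k
  *-homo c d zero    = refl
  *-homo c d (suc k) = sym (ℤ.*-zeroʳ c)

-- Products and theta functions as truncated series

progression : ℕ → ℕ → ℕ → PowerSeries
progression e d i = q^ (e ℕ.+ i ℕ.* d)

module ThetaFunction (K : ℕ) where

  module R = CommutativeRing (truncatedSeries K)
  open R public using (_≈_; setoid; *-cong; *-congˡ; *-congʳ; +-cong; +-congˡ; +-congʳ; -‿cong; *-identityˡ; *-identityʳ)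
  open RingWithIntegers (truncatedSeries K) (constant-homomorphism K) public
  open JacobiTripleProduct (truncatedSeries K) (constant-homomorphism K)

  ⊛≈· : ∀ p r → p ⊛ r ≈ p · r
  ⊛≈· p r = ≗⇒≈ (sym ∘ ·-coefficient p r)

  q-cong : ∀ {a b} → a ≡ b → q^ a ≈ q^ b
  q-cong = R.reflexive ∘ cong q^_

  -- (q^e; q^d)_n
  pochhammer : ℕ → ℕ → ℕ → PowerSeries
  pochhammer e d = ∏ (λ i → 1ₛ ⊖ progression e d i)

  pochhammer-coefficient-0 : ∀ e d n → pochhammer (suc e) d n 0 ≡ 1ℤ
  pochhammer-coefficient-0 e d zero    = refl
  pochhammer-coefficient-0 e d (suc n) = trans (·-coefficient (pochhammer (suc e) d n) (1ₛ ⊖ progression (suc e) d n) 0)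
    (cong (λ x → x * 1ℤ + 0ℤ) (pochhammer-coefficient-0 e d n))

  pochhammer-stable : ∀ e d {m n} → K ℕ.< e ℕ.+ m ℕ.* d → m ℕ.≤ n → pochhammer e d n ≈ pochhammer e d m
  pochhammer-stable e d {m} K<e+m*d m≤n = go (ℕ.≤⇒≤′ m≤n)
    where
    go : ∀ {n} → m ℕ.≤′ n → pochhammer e d n ≈ pochhammer e d m
    go ℕ.≤′-refl = R.refl
    go (ℕ.≤′-step {n} m≤′n) = R.trans
      (coefficientwise λ {k} k≤K → trans (·-coefficient (pochhammer e d n) (1ₛ ⊖ progression e d n) k) (⊛-1⊖q^ (pochhammer e d n)
        (ℕ.≤-<-trans k≤K (ℕ.<-≤-trans K<e+m*d (ℕ.+-monoʳ-≤ e (ℕ.*-monoˡ-≤ d (ℕ.≤′⇒≤ m≤′n)))))))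
      (go m≤′n)

  f≈pochhammer : ∀ j .{{_ : NonZero j}} {N} → K ℕ.≤ N → f j ≈ pochhammer j j N
  f≈pochhammer j {N} K≤N = R.trans
    (coefficientwise λ k≤K → sym (partialProduct-stable j (ℕ.≤-trans k≤K K≤N)))
    (partialProduct≈pochhammer N)
    where
    partialProduct≈pochhammer : ∀ N → partialProduct j N ≈ pochhammer j j N
    partialProduct≈pochhammer zero    = R.refl
    partialProduct≈pochhammer (suc N) = R.trans (⊛≈· (partialProduct j N) (1ₛ ⊖ q^ (j ℕ.* suc N)))
      (*-cong (partialProduct≈pochhammer N)
        (R.reflexive (cong (λ e → 1ₛ ⊖ q^ e) (trans (ℕ.*-suc j N) (cong (j ℕ.+_) (ℕ.*-comm j N))))))

  thetaTerm : ℕ → ℕ → ℕ → PowerSeries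
  thetaTerm e d = signedPower (progression e d)

  -- Every factor of the term has positive order, so the order is at least m. This linear bound is
  -- far below the true quadratic exponent, but it suffices for vanishing modulo q^(K+1).
  thetaTerm-below : ∀ e d m {k} → k ℕ.< m → thetaTerm (suc e) d m k ≡ 0ℤ
  thetaTerm-below e d (suc m) {k} (s≤s k≤m) = cong -_ (trans (·-coefficient (q^ b) (thetaTerm (suc e) d m) k) (vanish (ℕ.<-≤-connex k b)))
    where
    b = suc e ℕ.+ m ℕ.* d
    vanish : k ℕ.< b ⊎ b ℕ.≤ k → (q^ b ⊛ thetaTerm (suc e) d m) k ≡ 0ℤ
    vanish (inj₁ k<b) = q^-⊛-< b (thetaTerm (suc e) d m) k<b
    vanish (inj₂ b≤k) with o , refl ← ℕ.m≤n⇒∃[o]m+o≡n b≤k =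
      trans (q^-⊛-+ b (thetaTerm (suc e) d m) o) (thetaTerm-below e d m (ℕ.≤-trans (s≤s (ℕ.m≤n+m o _)) k≤m))

  -- Truncation of Ramanujan's f(-q^u, -q^v) = Σ_{m ∈ ℤ} (-1)^m q^(u m(m+1)/2 + v m(m-1)/2).
  theta : ℕ → ℕ → ℕ → PowerSeries
  theta u v = symmetricSum (progression u (u ℕ.+ v)) (progression v (u ℕ.+ v))

  -- The step d = u + v is forced: it makes q^(u+id) q^(v+jd) equal to the power i + 1 + j of the
  -- base q^d. With u and v positive, the theta terms vanish from index K + 1 on.
  theta≈product : ∀ u v .{{_ : NonZero u}} .{{_ : NonZero v}} {N} → suc K ℕ.+ suc K ℕ.≤ N →
    let d = u ℕ.+ v in pochhammer u d N · pochhammer v d N · pochhammer d d N ≈ theta u v N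
  theta≈product (suc u) (suc v) {N} 2K+2≤N =
    tripleProduct (λ i → q^ (i ℕ.* d)) R.refl (λ i j → q-homo (i ℕ.* d) (j ℕ.* d) (ℕ.*-distribʳ-+ d i j))
      (λ n → recip (pochhammer d d n)) (λ n → ≗⇒≈ (·-recip (pochhammer d d n) (pochhammer-coefficient-0 (u ℕ.+ suc v) d n)))
      (progression (suc u) d) (progression (suc v) d) (progression-+ (suc u)) (progression-+ (suc v)) u*v
      (suc K) stable (vanish u) (vanish v) 2K+2≤N
    where
    d = suc u ℕ.+ suc v

    q-homo : ∀ a b {c} → c ≡ a ℕ.+ b → q^ c ≈ q^ a · q^ b
    q-homo a b c≡a+b = R.trans (q-cong c≡a+b) (R.trans (≗⇒≈ (q^-homo-+ a b)) (⊛≈· (q^ a) (q^ b)))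

    progression-+ : ∀ e i j → progression e d (i ℕ.+ j) ≈ q^ (j ℕ.* d) · progression e d i
    progression-+ e i j = q-homo (j ℕ.* d) (e ℕ.+ i ℕ.* d) (lemma e i j d)
      where
      lemma : ∀ e i j d → e ℕ.+ (i ℕ.+ j) ℕ.* d ≡ j ℕ.* d ℕ.+ (e ℕ.+ i ℕ.* d)
      lemma = ℕ.solve-∀

    u*v : ∀ i j → progression (suc u) d i · progression (suc v) d j ≈ q^ ((i ℕ.+ suc j) ℕ.* d)
    u*v i j = R.sym (q-homo (suc u ℕ.+ i ℕ.* d) (suc v ℕ.+ j ℕ.* d) (lemma u v i j))
      where
      lemma : ∀ u v i j → (i ℕ.+ suc j) ℕ.* (suc u ℕ.+ suc v) ≡
        suc u ℕ.+ i ℕ.* (suc u ℕ.+ suc v) ℕ.+ (suc v ℕ.+ j ℕ.* (suc u ℕ.+ suc v))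
      lemma = ℕ.solve-∀

    stable : ∀ {n} → suc K ℕ.≤ n → pochhammer d d n ≈ pochhammer d d (suc K)
    stable = pochhammer-stable d d (ℕ.≤-trans (ℕ.m≤m*n (suc K) d) (ℕ.m≤n+m (suc K ℕ.* d) d))

    vanish : ∀ e {m} → suc K ℕ.≤ m → thetaTerm (suc e) d m ≈ 0ₛ
    vanish e {m} K<m = coefficientwise λ k≤K → thetaTerm-below e d m (ℕ.≤-<-trans k≤K K<m)

-- The 5-dissection

-- This is m(m-1)/2, the exponent collected by m factors of an arithmetic progression.
triangular : ℕ → ℕ
triangular zero    = 0
triangular (suc m) = m ℕ.+ triangular m

triangular-*5 : ∀ m → triangular (m ℕ.* 5) ≡ triangular m ℕ.* 25 ℕ.+ m ℕ.* 10
triangular-*5 zero    = refl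
triangular-*5 (suc m) rewrite triangular-*5 m = lemma m (triangular m)
  where
  lemma : ∀ m t → let x = m ℕ.* 5 in
    4 ℕ.+ x ℕ.+ (3 ℕ.+ x ℕ.+ (2 ℕ.+ x ℕ.+ (1 ℕ.+ x ℕ.+ (x ℕ.+ (t ℕ.* 25 ℕ.+ m ℕ.* 10))))) ≡
    (m ℕ.+ t) ℕ.* 25 ℕ.+ (10 ℕ.+ m ℕ.* 10)
  lemma = ℕ.solve-∀

alternating : ℕ → ℤ
alternating zero    = 1ℤ
alternating (suc m) = - alternating m

alternating-2+ : ∀ m → alternating (2 ℕ.+ m) ≡ alternating m
alternating-2+ m = ℤ.neg-involutive (alternating m)

alternating-*5 : ∀ m → alternating (m ℕ.* 5) ≡ alternating m
alternating-*5 zero    = refl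
alternating-*5 (suc m) = begin
  alternating (5 ℕ.+ m ℕ.* 5)  ≡⟨ alternating-2+ (3 ℕ.+ m ℕ.* 5) ⟩
  alternating (3 ℕ.+ m ℕ.* 5)  ≡⟨ alternating-2+ (1 ℕ.+ m ℕ.* 5) ⟩
  - alternating (m ℕ.* 5)      ≡⟨ cong -_ (alternating-*5 m) ⟩
  - alternating m              ∎
  where open ≡-Reasoning

monomial : ℤ → ℕ → PowerSeries
monomial c e = constant c · q^ e

monomial-coefficient : ∀ c e k → monomial c e k ≡ c * (q^ e) k
monomial-coefficient c e k = trans (·-coefficient (constant c) (q^ e) k) (constant-⊛ c (q^ e) k)

monomial-neg : ∀ c e → monomial (- c) e ≗ ⊝ monomial c e
monomial-neg c e k = begin
  monomial (- c) e k         ≡⟨ monomial-coefficient (- c) e k ⟩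
  - c * (q^ e) k             ≡⟨ ℤ.neg-distribˡ-* c ((q^ e) k) ⟨
  - (c * (q^ e) k)           ≡⟨ cong -_ (monomial-coefficient c e k) ⟨
  - monomial c e k           ∎
  where open ≡-Reasoning

expand₅-monomial : ∀ c e → expand₅ (monomial c e) ≗ monomial c (e ℕ.* 5)
expand₅-monomial c e k = begin
  expand₅ (monomial c e) k                ≡⟨ expand₅-cong-≤ k (λ {i} _ → monomial-coefficient c e i) ⟩
  expand₅ (λ i → c * (q^ e) i) k          ≡⟨ expand₅-scale c (q^ e) k ⟩
  c * expand₅ (q^ e) k                    ≡⟨ cong (c *_) (expand₅-q^ e k) ⟩
  c * (q^ (e ℕ.* 5)) k                    ≡⟨ monomial-coefficient c (e ℕ.* 5) k ⟨
  monomial c (e ℕ.* 5) k                  ∎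
  where open ≡-Reasoning

dissected : PowerSeries → PowerSeries → PowerSeries → PowerSeries
dissected x y z = expand₅ x ⊕ ⊝ (q^ 1 · expand₅ y ⊕ q^ 1 · expand₅ y) ⊕ (q^ 4 · expand₅ z ⊕ q^ 4 · expand₅ z)

module Dissection (K : ℕ) where

  open ThetaFunction K
  open import Relation.Binary.Reasoning.Setoid setoid

  q^-· : ∀ a b → q^ (a ℕ.+ b) ≈ q^ a · q^ b
  q^-· a b = R.trans (≗⇒≈ (q^-homo-+ a b)) (⊛≈· (q^ a) (q^ b))

  expand₅-cong : ∀ {p r} → p ≈ r → expand₅ p ≈ expand₅ r
  expand₅-cong p≈r = coefficientwise λ {k} k≤K → expand₅-cong-≤ k λ i≤k → coefficient p≈r (ℕ.≤-trans i≤k k≤K)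

  q^-⊛-monomial : ∀ a c e → q^ a · monomial c e ≈ monomial c (a ℕ.+ e)
  q^-⊛-monomial a c e = begin
    q^ a · (constant c · q^ e)  ≈⟨ solve 3 (λ x y z → x :* (y :* z) := y :* (x :* z)) R.refl (q^ a) (constant c) (q^ e) ⟩
    constant c · (q^ a · q^ e)  ≈⟨ *-congˡ (q^-· a e) ⟨
    constant c · q^ (a ℕ.+ e)   ∎

  -- For `e` = 1 and `d` = 2 this is m².
  exponent : ℕ → ℕ → ℕ → ℕ
  exponent e d m = m ℕ.* e ℕ.+ triangular m ℕ.* d

  thetaTerm≈monomial : ∀ e d m → thetaTerm e d m ≈ monomial (alternating m) (exponent e d m)
  thetaTerm≈monomial e d zero    = R.sym (R.trans (*-congʳ (≗⇒≈ (sym ∘ 1ₛ≗constant))) (*-identityˡ 1ₛ))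
  thetaTerm≈monomial e d (suc m) = begin
    ⊝ (progression e d m · thetaTerm e d m)
      ≈⟨ -‿cong (*-congˡ (thetaTerm≈monomial e d m)) ⟩
    ⊝ (q^ (e ℕ.+ m ℕ.* d) · monomial (alternating m) (exponent e d m))
      ≈⟨ -‿cong (q^-⊛-monomial (e ℕ.+ m ℕ.* d) (alternating m) (exponent e d m)) ⟩
    ⊝ monomial (alternating m) (e ℕ.+ m ℕ.* d ℕ.+ exponent e d m)
      ≈⟨ ≗⇒≈ (monomial-neg (alternating m) (e ℕ.+ m ℕ.* d ℕ.+ exponent e d m)) ⟨
    monomial (alternating (suc m)) (e ℕ.+ m ℕ.* d ℕ.+ exponent e d m)
      ≡⟨ cong (monomial (alternating (suc m))) (lemma e d m (triangular m)) ⟩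
    monomial (alternating (suc m)) (exponent e d (suc m)) ∎
    where
    lemma : ∀ e d m t → e ℕ.+ m ℕ.* d ℕ.+ (m ℕ.* e ℕ.+ t ℕ.* d) ≡ e ℕ.+ m ℕ.* e ℕ.+ (m ℕ.+ t) ℕ.* d
    lemma = ℕ.solve-∀

  q^-⊛-expand₅-thetaTerm : ∀ a e d m →
    q^ a · expand₅ (thetaTerm e d m) ≈ monomial (alternating m) (a ℕ.+ exponent e d m ℕ.* 5)
  q^-⊛-expand₅-thetaTerm a e d m = begin
    q^ a · expand₅ (thetaTerm e d m)
      ≈⟨ *-congˡ (expand₅-cong (thetaTerm≈monomial e d m)) ⟩
    q^ a · expand₅ (monomial (alternating m) (exponent e d m))
      ≈⟨ *-congˡ (≗⇒≈ (expand₅-monomial (alternating m) (exponent e d m))) ⟩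
    q^ a · monomial (alternating m) (exponent e d m ℕ.* 5)
      ≈⟨ q^-⊛-monomial a (alternating m) (exponent e d m ℕ.* 5) ⟩
    monomial (alternating m) (a ℕ.+ exponent e d m ℕ.* 5) ∎

  thetaTerm-even : ∀ M a e m → alternating M ≡ alternating m → exponent 1 2 M ≡ a ℕ.+ exponent e 10 m ℕ.* 5 →
    thetaTerm 1 2 M ≈ q^ a · expand₅ (thetaTerm e 10 m)
  thetaTerm-even M a e m signs exponents = begin
    thetaTerm 1 2 M                                         ≈⟨ thetaTerm≈monomial 1 2 M ⟩
    monomial (alternating M) (exponent 1 2 M)               ≡⟨ cong₂ monomial signs exponents ⟩
    monomial (alternating m) (a ℕ.+ exponent e 10 m ℕ.* 5)  ≈⟨ q^-⊛-expand₅-thetaTerm a e 10 m ⟨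
    q^ a · expand₅ (thetaTerm e 10 m)                       ∎

  thetaTerm-odd : ∀ M a e m → alternating M ≡ - alternating m → exponent 1 2 M ≡ a ℕ.+ exponent e 10 m ℕ.* 5 →
    thetaTerm 1 2 M ≈ ⊝ (q^ a · expand₅ (thetaTerm e 10 m))
  thetaTerm-odd M a e m signs exponents = begin
    thetaTerm 1 2 M                                             ≈⟨ thetaTerm≈monomial 1 2 M ⟩
    monomial (alternating M) (exponent 1 2 M)                   ≡⟨ cong₂ monomial signs exponents ⟩
    monomial (- alternating m) (a ℕ.+ exponent e 10 m ℕ.* 5)    ≈⟨ ≗⇒≈ (monomial-neg (alternating m) (a ℕ.+ exponent e 10 m ℕ.* 5)) ⟩
    ⊝ monomial (alternating m) (a ℕ.+ exponent e 10 m ℕ.* 5)    ≈⟨ -‿cong (q^-⊛-expand₅-thetaTerm a e 10 m) ⟨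
    ⊝ (q^ a · expand₅ (thetaTerm e 10 m))                       ∎

  alternating-3+*5 : ∀ N → alternating (3 ℕ.+ N ℕ.* 5) ≡ alternating (suc N)
  alternating-3+*5 N = trans (alternating-2+ (1 ℕ.+ N ℕ.* 5)) (cong -_ (alternating-*5 N))

  -- With m = N + 1, the indices 5N + 3, ..., 5N + 7 are 5m + s for s = -2, ..., 2. Here (5m + s)² =
  -- s² + 5(5m² + 2sm), and 5m² + 2sm is `exponent e 10 m` for e = 5 + 2s: this produces the
  -- parameters 1, 3, 5, 7, 9 and the shifts 4, 1, 0, 1, 4. The sign changes by (-1)^s.
  thetaTerm-3 : ∀ N → thetaTerm 1 2 (3 ℕ.+ N ℕ.* 5) ≈ q^ 4 · expand₅ (thetaTerm 1 10 (suc N))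
  thetaTerm-3 N = thetaTerm-even (3 ℕ.+ N ℕ.* 5) 4 1 (suc N) (alternating-3+*5 N) exponents
    where
    lemma : ∀ n t → let x = n ℕ.* 5 in
      (3 ℕ.+ x) ℕ.* 1 ℕ.+ (2 ℕ.+ x ℕ.+ (1 ℕ.+ x ℕ.+ (x ℕ.+ (t ℕ.* 25 ℕ.+ n ℕ.* 10)))) ℕ.* 2 ≡
      4 ℕ.+ (suc n ℕ.* 1 ℕ.+ (n ℕ.+ t) ℕ.* 10) ℕ.* 5
    lemma = ℕ.solve-∀
    exponents : exponent 1 2 (3 ℕ.+ N ℕ.* 5) ≡ 4 ℕ.+ exponent 1 10 (suc N) ℕ.* 5
    exponents rewrite triangular-*5 N = lemma N (triangular N)

  thetaTerm-4 : ∀ N → thetaTerm 1 2 (4 ℕ.+ N ℕ.* 5) ≈ ⊝ (q^ 1 · expand₅ (thetaTerm 3 10 (suc N)))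
  thetaTerm-4 N = thetaTerm-odd (4 ℕ.+ N ℕ.* 5) 1 3 (suc N) (cong -_ (alternating-3+*5 N)) exponents
    where
    lemma : ∀ n t → let x = n ℕ.* 5 in
      (4 ℕ.+ x) ℕ.* 1 ℕ.+ (3 ℕ.+ x ℕ.+ (2 ℕ.+ x ℕ.+ (1 ℕ.+ x ℕ.+ (x ℕ.+ (t ℕ.* 25 ℕ.+ n ℕ.* 10))))) ℕ.* 2 ≡
      1 ℕ.+ (suc n ℕ.* 3 ℕ.+ (n ℕ.+ t) ℕ.* 10) ℕ.* 5
    lemma = ℕ.solve-∀
    exponents : exponent 1 2 (4 ℕ.+ N ℕ.* 5) ≡ 1 ℕ.+ exponent 3 10 (suc N) ℕ.* 5
    exponents rewrite triangular-*5 N = lemma N (triangular N)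

  thetaTerm-5 : ∀ N → thetaTerm 1 2 (5 ℕ.+ N ℕ.* 5) ≈ expand₅ (thetaTerm 5 10 (suc N))
  thetaTerm-5 N = R.trans
    (thetaTerm-even (5 ℕ.+ N ℕ.* 5) 0 5 (suc N) (trans (alternating-2+ (3 ℕ.+ N ℕ.* 5)) (alternating-3+*5 N)) exponents)
    (*-identityˡ (expand₅ (thetaTerm 5 10 (suc N))))
    where
    lemma : ∀ n t → let x = n ℕ.* 5 in
      (5 ℕ.+ x) ℕ.* 1 ℕ.+ ((n ℕ.+ t) ℕ.* 25 ℕ.+ suc n ℕ.* 10) ℕ.* 2 ≡
      0 ℕ.+ (suc n ℕ.* 5 ℕ.+ (n ℕ.+ t) ℕ.* 10) ℕ.* 5
    lemma = ℕ.solve-∀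
    exponents : exponent 1 2 (5 ℕ.+ N ℕ.* 5) ≡ 0 ℕ.+ exponent 5 10 (suc N) ℕ.* 5
    exponents = trans (cong (λ t → (5 ℕ.+ N ℕ.* 5) ℕ.* 1 ℕ.+ t ℕ.* 2) (triangular-*5 (suc N))) (lemma N (triangular N))

  thetaTerm-6 : ∀ N → thetaTerm 1 2 (6 ℕ.+ N ℕ.* 5) ≈ ⊝ (q^ 1 · expand₅ (thetaTerm 7 10 (suc N)))
  thetaTerm-6 N = thetaTerm-odd (6 ℕ.+ N ℕ.* 5) 1 7 (suc N) (cong -_ (alternating-*5 (suc N))) exponents
    where
    lemma : ∀ n t → let x = n ℕ.* 5 in
      (6 ℕ.+ x) ℕ.* 1 ℕ.+ (5 ℕ.+ x ℕ.+ ((n ℕ.+ t) ℕ.* 25 ℕ.+ suc n ℕ.* 10)) ℕ.* 2 ≡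
      1 ℕ.+ (suc n ℕ.* 7 ℕ.+ (n ℕ.+ t) ℕ.* 10) ℕ.* 5
    lemma = ℕ.solve-∀
    exponents : exponent 1 2 (6 ℕ.+ N ℕ.* 5) ≡ 1 ℕ.+ exponent 7 10 (suc N) ℕ.* 5
    exponents = trans (cong (λ t → (6 ℕ.+ N ℕ.* 5) ℕ.* 1 ℕ.+ (5 ℕ.+ N ℕ.* 5 ℕ.+ t) ℕ.* 2) (triangular-*5 (suc N)))
      (lemma N (triangular N))

  thetaTerm-7 : ∀ N → thetaTerm 1 2 (7 ℕ.+ N ℕ.* 5) ≈ q^ 4 · expand₅ (thetaTerm 9 10 (suc N))
  thetaTerm-7 N = thetaTerm-even (7 ℕ.+ N ℕ.* 5) 4 9 (suc N) (trans (alternating-2+ (5 ℕ.+ N ℕ.* 5)) (alternating-*5 (suc N))) exponents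
    where
    lemma : ∀ n t → let x = n ℕ.* 5 in
      (7 ℕ.+ x) ℕ.* 1 ℕ.+ (6 ℕ.+ x ℕ.+ (5 ℕ.+ x ℕ.+ ((n ℕ.+ t) ℕ.* 25 ℕ.+ suc n ℕ.* 10))) ℕ.* 2 ≡
      4 ℕ.+ (suc n ℕ.* 9 ℕ.+ (n ℕ.+ t) ℕ.* 10) ℕ.* 5
    lemma = ℕ.solve-∀
    exponents : exponent 1 2 (7 ℕ.+ N ℕ.* 5) ≡ 4 ℕ.+ exponent 9 10 (suc N) ℕ.* 5
    exponents = trans (cong (λ t → (7 ℕ.+ N ℕ.* 5) ℕ.* 1 ℕ.+ (6 ℕ.+ N ℕ.* 5 ℕ.+ (5 ℕ.+ N ℕ.* 5 ℕ.+ t)) ℕ.* 2) (triangular-*5 (suc N)))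
      (lemma N (triangular N))

  expand₅-1ₛ : expand₅ 1ₛ ≈ 1ₛ
  expand₅-1ₛ = ≗⇒≈ (expand₅-q^ 0)

  expand₅-theta-suc : ∀ u v N → expand₅ (theta u v (suc N)) ≈
    expand₅ (theta u v N) ⊕ (expand₅ (thetaTerm u (u ℕ.+ v) (suc N)) ⊕ expand₅ (thetaTerm v (u ℕ.+ v) (suc N)))
  expand₅-theta-suc u v N = R.trans
    (≗⇒≈ (expand₅-⊕ (theta u v N) (thetaTerm u (u ℕ.+ v) (suc N) ⊕ thetaTerm v (u ℕ.+ v) (suc N))))
    (+-congˡ {expand₅ (theta u v N)} (≗⇒≈ (expand₅-⊕ (thetaTerm u (u ℕ.+ v) (suc N)) (thetaTerm v (u ℕ.+ v) (suc N)))))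

  -- The cut at 2 + 5N ends exactly at a block 5m - 2, ..., 5m + 2, so the identity between
  -- truncations has no remainder. Opposite indices have equal squares; hence s and -s feed the two
  -- halves of the same theta function, and it appears doubled for s ≠ 0.
  theta-dissection : ∀ N → theta 1 1 (2 ℕ.+ N ℕ.* 5) ≈ dissected (theta 5 5 N) (theta 7 3 N) (theta 9 1 N)
  theta-dissection zero = begin
    (1ₛ ⊕ (t₁ ⊕ t₁)) ⊕ (t₂ ⊕ t₂)
      ≈⟨ +-cong (+-congˡ {1ₛ} (+-cong t₁≈ t₁≈)) (+-cong t₂≈ t₂≈) ⟩
    (1ₛ ⊕ (⊝ x₁ ⊕ ⊝ x₁)) ⊕ (x₄ ⊕ x₄)
      ≈⟨ +-congʳ (+-cong (R.sym expand₅-1ₛ) (solve 1 (λ x → (:- x) :+ (:- x) := :- (x :+ x)) R.refl x₁)) ⟩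
    dissected 1ₛ 1ₛ 1ₛ ∎
    where
    t₁ = thetaTerm 1 2 1
    t₂ = thetaTerm 1 2 2
    x₁ = q^ 1 · expand₅ 1ₛ
    x₄ = q^ 4 · expand₅ 1ₛ
    t₁≈ : t₁ ≈ ⊝ x₁
    t₁≈ = thetaTerm-odd 1 1 0 0 refl refl
    t₂≈ : t₂ ≈ x₄
    t₂≈ = thetaTerm-even 2 4 0 0 refl refl
  theta-dissection (suc N) = begin
    θ₁ ⊕ (t 3 ⊕ t 3) ⊕ (t 4 ⊕ t 4) ⊕ (t 5 ⊕ t 5) ⊕ (t 6 ⊕ t 6) ⊕ (t 7 ⊕ t 7)
      ≈⟨ +-cong (+-cong (+-cong (+-cong (+-cong (theta-dissection N)
           (double (thetaTerm-3 N))) (double (thetaTerm-4 N))) (double (thetaTerm-5 N))) (double (thetaTerm-6 N))) (double (thetaTerm-7 N)) ⟩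
    dissected (theta 5 5 N) (theta 7 3 N) (theta 9 1 N)
      ⊕ (q^ 4 · e 1 ⊕ q^ 4 · e 1) ⊕ (⊝ (q^ 1 · e 3) ⊕ ⊝ (q^ 1 · e 3)) ⊕ (e 5 ⊕ e 5)
      ⊕ (⊝ (q^ 1 · e 7) ⊕ ⊝ (q^ 1 · e 7)) ⊕ (q^ 4 · e 9 ⊕ q^ 4 · e 9)
      ≈⟨ solve 10 (λ x y z a b e₁ e₃ e₅ e₇ e₉ →
           x :+ (:- (a :* y :+ a :* y)) :+ (b :* z :+ b :* z)
           :+ (b :* e₁ :+ b :* e₁) :+ ((:- (a :* e₃)) :+ (:- (a :* e₃))) :+ (e₅ :+ e₅)
           :+ ((:- (a :* e₇)) :+ (:- (a :* e₇))) :+ (b :* e₉ :+ b :* e₉)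
           := (x :+ (e₅ :+ e₅)) :+ (:- (a :* (y :+ (e₇ :+ e₃)) :+ a :* (y :+ (e₇ :+ e₃))))
              :+ (b :* (z :+ (e₉ :+ e₁)) :+ b :* (z :+ (e₉ :+ e₁))))
           R.refl (expand₅ (theta 5 5 N)) (expand₅ (theta 7 3 N)) (expand₅ (theta 9 1 N))
           (q^ 1) (q^ 4) (e 1) (e 3) (e 5) (e 7) (e 9) ⟩
    (expand₅ (theta 5 5 N) ⊕ (e 5 ⊕ e 5))
      ⊕ ⊝ (q^ 1 · (expand₅ (theta 7 3 N) ⊕ (e 7 ⊕ e 3)) ⊕ q^ 1 · (expand₅ (theta 7 3 N) ⊕ (e 7 ⊕ e 3)))
      ⊕ (q^ 4 · (expand₅ (theta 9 1 N) ⊕ (e 9 ⊕ e 1)) ⊕ q^ 4 · (expand₅ (theta 9 1 N) ⊕ (e 9 ⊕ e 1)))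
      ≈⟨ +-cong (+-cong (expand₅-theta-suc 5 5 N)
           (-‿cong (double (*-congˡ (expand₅-theta-suc 7 3 N))))) (double (*-congˡ (expand₅-theta-suc 9 1 N))) ⟨
    dissected (theta 5 5 (suc N)) (theta 7 3 (suc N)) (theta 9 1 (suc N)) ∎
    where
    θ₁ = theta 1 1 (2 ℕ.+ N ℕ.* 5)
    t e : ℕ → PowerSeries
    t i = thetaTerm 1 2 (i ℕ.+ N ℕ.* 5)
    e i = expand₅ (thetaTerm i 10 (suc N))
    double : ∀ {p r} → p ≈ r → p ⊕ p ≈ r ⊕ r
    double p≈r = +-cong p≈r p≈r

-- Positivity

infix 4 _≽_

_≽_ : PowerSeries → PowerSeries → Set
p ≽ r = ∀ n → r n ≤ p n

0≤1ₛ : 1ₛ ≽ 0ₛ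
0≤1ₛ zero    = +≤+ z≤n
0≤1ₛ (suc n) = ℤ.≤-refl

0≤* : ∀ {i j} → 0ℤ ≤ i → 0ℤ ≤ j → 0ℤ ≤ i * j
0≤* {j = j} 0≤i 0≤j = ℤ.≤-trans (ℤ.≤-reflexive (sym (ℤ.*-zeroˡ j))) (ℤ.*-monoʳ-≤-nonNeg j {{nonNegative 0≤j}} 0≤i)

⊛-nonNegative : ∀ {p r} → p ≽ 0ₛ → r ≽ 0ₛ → p ⊛ r ≽ 0ₛ
⊛-nonNegative p≽0 r≽0 zero    = ℤ.+-mono-≤ (0≤* (p≽0 0) (r≽0 0)) (ℤ.≤-refl {0ℤ})
⊛-nonNegative p≽0 r≽0 (suc n) = ℤ.+-mono-≤ (0≤* (p≽0 0) (r≽0 (suc n))) (⊛-nonNegative (p≽0 ∘ suc) r≽0 n)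

-- The summand with index 0 in the convolution already dominates `r n`, and the others are
-- nonnegative.
⊛-≽ : ∀ {p r} → p ≽ 1ₛ → r ≽ 0ₛ → p ⊛ r ≽ r
⊛-≽ {p} {r} p≽1 r≽0 n = ℤ.≤-trans (r≤p₀*r n) (p₀*r≤p⊛r n)
  where
  r≤p₀*r : ∀ n → r n ≤ p 0 * r n
  r≤p₀*r n = ℤ.≤-trans (ℤ.≤-reflexive (sym (ℤ.*-identityˡ (r n))))
    (ℤ.*-monoʳ-≤-nonNeg (r n) {{nonNegative (r≽0 n)}} (p≽1 0))
  p₀*r≤p⊛r : ∀ n → p 0 * r n ≤ (p ⊛ r) n
  p₀*r≤p⊛r zero    = ℤ.≤-reflexive (sym (ℤ.+-identityʳ (p 0 * r 0)))
  p₀*r≤p⊛r (suc n) = ℤ.≤-trans (ℤ.≤-reflexive (sym (ℤ.+-identityʳ (p 0 * r (suc n)))))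
    (ℤ.+-monoʳ-≤ (p 0 * r (suc n)) (⊛-nonNegative (p≽1 ∘ suc) r≽0 n))

-- The shifted index gives `1ₛ ⊖ q^ suc e` constant term 1 for every `e`, as `recip` requires.
geometric : ℕ → PowerSeries
geometric e = recip (1ₛ ⊖ q^ suc e)

geometric-inverse : ∀ e → (1ₛ ⊖ q^ suc e) · geometric e ≗ 1ₛ
geometric-inverse e = ·-recip (1ₛ ⊖ q^ suc e) refl

module GeometricSeries (K : ℕ) where

  open ThetaFunction K
  open JacobiTripleProduct (truncatedSeries K) (constant-homomorphism K) using ([1-x]*y≈y-x*y)
  open import Relation.Binary.Reasoning.Setoid setoid

  geometric-unfold : ∀ e → geometric e ≈ 1ₛ ⊕ q^ suc e · geometric e
  geometric-unfold e = begin
    g                                                 ≈⟨ solve 2 (λ g y → g := (g :- y) :+ y) R.refl g (q^ suc e · g) ⟩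
    g ⊕ ⊝ (q^ suc e · g) ⊕ q^ suc e · g               ≈⟨ +-congʳ ([1-x]*y≈y-x*y (q^ suc e) g) ⟨
    (1ₛ ⊖ q^ suc e) · g ⊕ q^ suc e · g                ≈⟨ +-congʳ (≗⇒≈ (geometric-inverse e)) ⟩
    1ₛ ⊕ q^ suc e · g                                 ∎
    where g = geometric e

geometric-coefficient : ∀ e n → geometric e n ≡ 1ₛ n + (q^ suc e ⊛ geometric e) n
geometric-coefficient e n = trans (coefficient (GeometricSeries.geometric-unfold n e) ℕ.≤-refl)
  (cong (1ₛ n +_) (·-coefficient (q^ suc e) (geometric e) n))

-- Strong induction along g = 1 + q^(e+1) g; no formula for the coefficients is needed.
geometric-≽-0ₛ : ∀ e → geometric e ≽ 0ₛ
geometric-≽-0ₛ e = <-rec (λ n → 0ℤ ≤ geometric e n) λ n rec → ℤ.≤-trans (ℤ.+-mono-≤ (0≤1ₛ n) (step n rec (ℕ.<-≤-connex n (suc e)))) (ℤ.≤-reflexive (sym (geometric-coefficient e n)))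
  where
  step : ∀ n → (∀ {m} → m ℕ.< n → 0ℤ ≤ geometric e m) → n ℕ.< suc e ⊎ suc e ℕ.≤ n → 0ℤ ≤ (q^ suc e ⊛ geometric e) n
  step n rec (inj₁ n<1+e) = ℤ.≤-reflexive (sym (q^-⊛-< (suc e) (geometric e) n<1+e))
  step n rec (inj₂ 1+e≤n) with m , refl ← ℕ.m≤n⇒∃[o]m+o≡n 1+e≤n =
    ℤ.≤-trans (rec (s≤s (ℕ.m≤n+m m e))) (ℤ.≤-reflexive (sym (q^-⊛-+ (suc e) (geometric e) m)))

geometric-≽-1ₛ : ∀ e → geometric e ≽ 1ₛ
geometric-≽-1ₛ e zero    = ℤ.≤-refl
geometric-≽-1ₛ e (suc n) = geometric-≽-0ₛ e (suc n)

-- Strictness of the final inequalities originates here: 1/(1 - q) has no zero coefficient, whereas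
-- the other factors are only known to dominate 1.
geometric-0 : ∀ n → geometric 0 n ≡ 1ℤ
geometric-0 zero    = refl
geometric-0 (suc n) = trans (geometric-coefficient 0 (suc n))
  (trans (ℤ.+-identityˡ _) (trans (q^-⊛-+ 1 (geometric 0) n) (geometric-0 n)))

-- Division of the theta products by f₁²

1/f₁² : PowerSeries
1/f₁² = recip (f 1 · f 1)

module Positivity (K : ℕ) where

  open ThetaFunction K
  open import Relation.Binary.Reasoning.Setoid setoid

  -- The series β/(q;q)_M with a lower bound `L` on its coefficients. As `M` grows by one, the new
  -- denominator factor is either expanded as a geometric series (`extend-1`) or cancelled by a new
  -- factor of β (`absorb`); neither lowers the bound.
  record Quotient (L β : PowerSeries) (M : ℕ) : Set where
    field
      quotient  : PowerSeries
      β≈product : β ≈ pochhammer 1 1 M · quotient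
      quotient≽ : quotient ≽ L

  open Quotient

  Quotient-≡ : ∀ {L β M M′} → M ≡ M′ → Quotient L β M → Quotient L β M′
  Quotient-≡ refl Q = Q

  Quotient-≈ : ∀ {L β β′ M} → β ≈ β′ → Quotient L β M → Quotient L β′ M
  Quotient-≈ β≈β′ Q = record
    { quotient  = quotient Q
    ; β≈product = R.trans (R.sym β≈β′) (β≈product Q)
    ; quotient≽ = quotient≽ Q
    }

  extend-1 : ∀ {L β M} → L ≽ 0ₛ → Quotient L β M → Quotient L β (suc M)
  extend-1 {L} {β} {M} L≽0 Q = record
    { quotient  = geometric M · quotient Q
    ; β≈product = begin
        β
          ≈⟨ β≈product Q ⟩
        pochhammer 1 1 M · quotient Q
          ≈⟨ *-congʳ (*-identityʳ (pochhammer 1 1 M)) ⟨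
        pochhammer 1 1 M · 1ₛ · quotient Q
          ≈⟨ *-congʳ (*-congˡ inverse) ⟨
        pochhammer 1 1 M · ((1ₛ ⊖ progression 1 1 M) · geometric M) · quotient Q
          ≈⟨ solve 4 (λ a b c d → a :* (b :* c) :* d := a :* b :* (c :* d)) R.refl
               (pochhammer 1 1 M) (1ₛ ⊖ progression 1 1 M) (geometric M) (quotient Q) ⟩
        pochhammer 1 1 (suc M) · (geometric M · quotient Q) ∎
    ; quotient≽ = λ n → ℤ.≤-trans (ℤ.≤-trans (quotient≽ Q n)
        (⊛-≽ (geometric-≽-1ₛ M) (λ k → ℤ.≤-trans (L≽0 k) (quotient≽ Q k)) n))
        (ℤ.≤-reflexive (sym (·-coefficient (geometric M) (quotient Q) n)))
    }
    where
    inverse : (1ₛ ⊖ progression 1 1 M) · geometric M ≈ 1ₛ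
    inverse = R.trans (*-congʳ (R.reflexive (cong (λ e → 1ₛ ⊖ q^ suc e) (ℕ.*-identityʳ M)))) (≗⇒≈ (geometric-inverse M))

  extend : ∀ {L β M} → L ≽ 0ₛ → ∀ i → Quotient L β M → Quotient L β (i ℕ.+ M)
  extend L≽0 zero    Q = Q
  extend L≽0 (suc i) Q = extend-1 L≽0 (extend L≽0 i Q)

  absorb : ∀ {L β M e} → e ≡ suc M → Quotient L β M → Quotient L (β · (1ₛ ⊖ q^ e)) (suc M)
  absorb {L} {β} {M} {e} e≡1+M Q = record
    { quotient  = quotient Q
    ; β≈product = begin
        β · (1ₛ ⊖ q^ e)
          ≈⟨ *-congʳ (β≈product Q) ⟩
        pochhammer 1 1 M · quotient Q · (1ₛ ⊖ q^ e)
          ≈⟨ solve 3 (λ a b c → a :* b :* c := a :* c :* b) R.refl (pochhammer 1 1 M) (quotient Q) (1ₛ ⊖ q^ e) ⟩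
        pochhammer 1 1 M · (1ₛ ⊖ q^ e) · quotient Q
          ≡⟨ cong (λ b → pochhammer 1 1 M · (1ₛ ⊖ q^ b) · quotient Q) (trans e≡1+M (sym (cong suc (ℕ.*-identityʳ M)))) ⟩
        pochhammer 1 1 (suc M) · quotient Q ∎
    ; quotient≽ = quotient≽ Q
    }

  -- In each block of `d` consecutive denominator factors exactly one is cancelled; `i` and `j`
  -- count those before and after it.
  quotient₁ : ∀ i j N → let d = suc j ℕ.+ i in Quotient 1ₛ (pochhammer (suc i) d N) (N ℕ.* d)
  quotient₁ i j zero    = record { quotient = 1ₛ ; β≈product = R.sym (*-identityˡ 1ₛ) ; quotient≽ = λ _ → ℤ.≤-refl }
  quotient₁ i j (suc N) = Quotient-≡ (lemma i j (N ℕ.* d))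
    (extend 0≤1ₛ j (absorb refl (extend 0≤1ₛ i (quotient₁ i j N))))
    where
    d = suc j ℕ.+ i
    lemma : ∀ i j x → j ℕ.+ suc (i ℕ.+ x) ≡ suc j ℕ.+ i ℕ.+ x
    lemma = ℕ.solve-∀

  -- The blocks of d factors that absorb β start at 1 - q², so the factor 1/(1 - q) survives.
  quotient₂ : ∀ i j N → let d = 3 ℕ.+ j ℕ.+ i in
    Quotient (geometric 0) (pochhammer (2 ℕ.+ i) d N · pochhammer d d N) (1 ℕ.+ N ℕ.* d)
  quotient₂ i j zero    = record
    { quotient  = geometric 0
    ; β≈product = R.trans (*-identityˡ 1ₛ) (R.sym (R.trans (*-congʳ (*-identityˡ (1ₛ ⊖ q^ 1))) (≗⇒≈ (geometric-inverse 0))))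
    ; quotient≽ = λ _ → ℤ.≤-refl
    }
  quotient₂ i j (suc N) = Quotient-≈
    (solve 4 (λ a b c d → a :* b :* c :* d := a :* c :* (b :* d)) R.refl
      (pochhammer (2 ℕ.+ i) d N) (pochhammer d d N) (1ₛ ⊖ progression (2 ℕ.+ i) d N) (1ₛ ⊖ progression d d N))
    (Quotient-≡ (cong suc (lemma i j (N ℕ.* d)))
      -- Read from the inside, the cancelled exponents are 2 + i + Nd and d + Nd. The last
      -- `extend-1` supplies 1 + (N+1)d, which closes the block so that the next one starts at 2 +
      -- (N+1)d.
      (extend-1 L≽0 (absorb (sym (lemma i j (N ℕ.* d))) (extend L≽0 j (absorb (cong suc (sym (ℕ.+-suc i (N ℕ.* d)))) (extend L≽0 i (quotient₂ i j N)))))))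
    where
    d = 3 ℕ.+ j ℕ.+ i
    L≽0 = geometric-≽-0ₛ 0
    lemma : ∀ i j x → suc (j ℕ.+ suc (i ℕ.+ (1 ℕ.+ x))) ≡ 3 ℕ.+ j ℕ.+ i ℕ.+ x
    lemma = ℕ.solve-∀

  f₁²-inverse : f 1 · f 1 · 1/f₁² ≈ 1ₛ
  f₁²-inverse = ≗⇒≈ (·-recip (f 1 · f 1) (·-coefficient (f 1) (f 1) 0))

  -- One f₁ absorbs the products starting at q^u and q^d, the other absorbs the one starting at q^v.
  -- The denominators of both quotients have more than K - 1 factors, so each agrees with f₁ modulo
  -- q^(K+1). What remains is `G₁ · G₂` with `G₁` above 1 and `G₂` above 1/(1 - q).
  theta/f₁²-positive : ∀ u v .{{_ : NonZero u}} .{{_ : NonZero v}} N → suc K ℕ.+ suc K ℕ.≤ N → let d = u ℕ.+ v in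
    Quotient (geometric 0) (pochhammer u d N · pochhammer d d N) (1 ℕ.+ N ℕ.* d) →
    Quotient 1ₛ (pochhammer v d N) (N ℕ.* d) →
    ∀ {k} → k ℕ.≤ K → (theta u v N · 1/f₁²) k > 0ℤ
  theta/f₁²-positive u@(suc _) v N 2K+2≤N Q₂ Q₁ {k} k≤K = ℤ.<-≤-trans (+<+ (s≤s z≤n)) (ℤ.≤-trans 1≤ (ℤ.≤-reflexive (sym (coefficient theta/f₁² k≤K))))
    where
    d = u ℕ.+ v
    G₁ = quotient Q₁
    G₂ = quotient Q₂
    K≤N : K ℕ.≤ N
    K≤N = ℕ.≤-trans (ℕ.n≤1+n K) (ℕ.m+n≤o⇒m≤o (suc K) 2K+2≤N)
    K≤N*d : K ℕ.≤ N ℕ.* d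
    K≤N*d = ℕ.≤-trans K≤N (ℕ.m≤m*n N d)

    theta/f₁² : theta u v N · 1/f₁² ≈ G₁ · G₂
    theta/f₁² = begin
      theta u v N · 1/f₁²
        ≈⟨ *-congʳ (theta≈product u v 2K+2≤N) ⟨
      pochhammer u d N · pochhammer v d N · pochhammer d d N · 1/f₁²
        ≈⟨ solve 4 (λ a b c e → a :* b :* c :* e := a :* c :* b :* e) R.refl
             (pochhammer u d N) (pochhammer v d N) (pochhammer d d N) 1/f₁² ⟩
      pochhammer u d N · pochhammer d d N · pochhammer v d N · 1/f₁²
        ≈⟨ *-congʳ (*-cong (β≈product Q₂) (β≈product Q₁)) ⟩
      pochhammer 1 1 (1 ℕ.+ N ℕ.* d) · G₂ · (pochhammer 1 1 (N ℕ.* d) · G₁) · 1/f₁²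
        ≈⟨ *-congʳ (*-cong (*-congʳ (f≈pochhammer 1 (ℕ.m≤n⇒m≤1+n K≤N*d))) (*-congʳ (f≈pochhammer 1 K≤N*d))) ⟨
      f 1 · G₂ · (f 1 · G₁) · 1/f₁²
        ≈⟨ solve 4 (λ a b c e → a :* b :* (a :* c) :* e := a :* a :* e :* (c :* b)) R.refl (f 1) G₂ G₁ 1/f₁² ⟩
      f 1 · f 1 · 1/f₁² · (G₁ · G₂)
        ≈⟨ *-congʳ f₁²-inverse ⟩
      1ₛ · (G₁ · G₂)
        ≈⟨ *-identityˡ (G₁ · G₂) ⟩
      G₁ · G₂ ∎

    1≤ : 1ℤ ≤ (G₁ · G₂) k
    1≤ = ℤ.≤-trans (ℤ.≤-reflexive (sym (geometric-0 k))) (ℤ.≤-trans (quotient≽ Q₂ k)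
      (ℤ.≤-trans (⊛-≽ {G₁} {G₂} (quotient≽ Q₁) (λ n → ℤ.≤-trans (geometric-≽-0ₛ 0 n) (quotient≽ Q₂ n)) k)
        (ℤ.≤-reflexive (sym (·-coefficient G₁ G₂ k)))))

-- The coefficients

module Reduction (K : ℕ) where

  open ThetaFunction K
  open Dissection K using (expand₅-cong; expand₅-1ₛ; theta-dissection)
  open Positivity K using (f₁²-inverse; theta/f₁²-positive; quotient₁; quotient₂)
  open import Relation.Binary.Reasoning.Setoid setoid

  pochhammer-even-odd : ∀ N → pochhammer 1 1 (N ℕ.* 2) ≈ pochhammer 1 2 N · pochhammer 2 2 N
  pochhammer-even-odd zero    = R.sym (*-identityˡ 1ₛ)
  pochhammer-even-odd (suc N) = begin
    pochhammer 1 1 (N ℕ.* 2) · (1ₛ ⊖ progression 1 1 (N ℕ.* 2)) · (1ₛ ⊖ progression 1 1 (suc (N ℕ.* 2)))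
      ≈⟨ *-cong (*-cong (pochhammer-even-odd N) (factor (N ℕ.* 2))) (factor (suc (N ℕ.* 2))) ⟩
    pochhammer 1 2 N · pochhammer 2 2 N · (1ₛ ⊖ progression 1 2 N) · (1ₛ ⊖ progression 2 2 N)
      ≈⟨ solve 4 (λ x y z w → x :* y :* z :* w := x :* z :* (y :* w)) R.refl
           (pochhammer 1 2 N) (pochhammer 2 2 N) (1ₛ ⊖ progression 1 2 N) (1ₛ ⊖ progression 2 2 N) ⟩
    pochhammer 1 2 (suc N) · pochhammer 2 2 (suc N) ∎
    where
    factor : ∀ i → 1ₛ ⊖ progression 1 1 i ≈ 1ₛ ⊖ q^ suc i
    factor i = R.reflexive (cong (λ e → 1ₛ ⊖ q^ suc e) (ℕ.*-identityʳ i))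

  -- Since f₁ = (q;q²)(q²;q²), its square is the triple product (q;q²)²(q²;q²) times one spare
  -- (q²;q²) = f₂.
  f₁²≈theta·f₂ : ∀ {N} → suc K ℕ.+ suc K ℕ.≤ N → f 1 · f 1 ≈ theta 1 1 N · f 2
  f₁²≈theta·f₂ {N} 2K+2≤N = begin
    f 1 · f 1
      ≈⟨ *-cong f₁≈ f₁≈ ⟩
    pochhammer 1 2 N · pochhammer 2 2 N · (pochhammer 1 2 N · pochhammer 2 2 N)
      ≈⟨ solve 2 (λ x y → x :* y :* (x :* y) := x :* x :* y :* y) R.refl (pochhammer 1 2 N) (pochhammer 2 2 N) ⟩
    pochhammer 1 2 N · pochhammer 1 2 N · pochhammer 2 2 N · pochhammer 2 2 N
      ≈⟨ *-cong (theta≈product 1 1 2K+2≤N) (R.sym (f≈pochhammer 2 K≤N)) ⟩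
    theta 1 1 N · f 2 ∎
    where
    K≤N : K ℕ.≤ N
    K≤N = ℕ.≤-trans (ℕ.n≤1+n K) (ℕ.m+n≤o⇒m≤o (suc K) 2K+2≤N)
    f₁≈ : f 1 ≈ pochhammer 1 2 N · pochhammer 2 2 N
    f₁≈ = R.trans (f≈pochhammer 1 (ℕ.≤-trans K≤N (ℕ.m≤m*n N 2))) (pochhammer-even-odd N)

  expand₅-· : ∀ p r → expand₅ (p · r) ≈ expand₅ p · expand₅ r
  expand₅-· p r = begin
    expand₅ (p · r)        ≡⟨ cong expand₅ (·≡⊛ p r) ⟩
    expand₅ (p ⊛ r)        ≈⟨ ≗⇒≈ (expand₅-⊛ p r) ⟩
    expand₅ p ⊛ expand₅ r  ≈⟨ ⊛≈· (expand₅ p) (expand₅ r) ⟩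
    expand₅ p · expand₅ r  ∎

  f₅≈expand₅-f₁ : f 5 ≈ expand₅ (f 1)
  f₅≈expand₅-f₁ = begin
    f 5                         ≈⟨ f≈pochhammer 5 ℕ.≤-refl ⟩
    pochhammer 5 5 K            ≈⟨ expand₅-pochhammer K ⟨
    expand₅ (pochhammer 1 1 K)  ≈⟨ expand₅-cong (f≈pochhammer 1 ℕ.≤-refl) ⟨
    expand₅ (f 1)               ∎
    where
    expand₅-1⊖q^ : ∀ e → expand₅ (1ₛ ⊖ q^ e) ≈ 1ₛ ⊖ q^ (e ℕ.* 5)
    expand₅-1⊖q^ e = ≗⇒≈ λ k → trans (expand₅-⊕ 1ₛ (⊝ (q^ e)) k)
      (cong₂ _+_ (expand₅-q^ 0 k) (trans (expand₅-⊝ (q^ e) k) (cong -_ (expand₅-q^ e k))))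

    expand₅-pochhammer : ∀ N → expand₅ (pochhammer 1 1 N) ≈ pochhammer 5 5 N
    expand₅-pochhammer zero    = expand₅-1ₛ
    expand₅-pochhammer (suc N) = R.trans (expand₅-· (pochhammer 1 1 N) (1ₛ ⊖ progression 1 1 N))
      (*-cong (expand₅-pochhammer N) (R.trans (expand₅-1⊖q^ (1 ℕ.+ N ℕ.* 1))
        (R.reflexive (cong (λ i → 1ₛ ⊖ q^ (5 ℕ.+ i ℕ.* 5)) (ℕ.*-identityʳ N)))))

  f₅²-inverse : f 5 · f 5 · expand₅ 1/f₁² ≈ 1ₛ
  f₅²-inverse = begin
    f 5 · f 5 · expand₅ 1/f₁²
      ≈⟨ *-congʳ (*-cong f₅≈expand₅-f₁ f₅≈expand₅-f₁) ⟩
    expand₅ (f 1) · expand₅ (f 1) · expand₅ 1/f₁²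
      ≈⟨ *-congʳ (expand₅-· (f 1) (f 1)) ⟨
    expand₅ (f 1 · f 1) · expand₅ 1/f₁²
      ≈⟨ expand₅-· (f 1 · f 1) 1/f₁² ⟨
    expand₅ (f 1 · f 1 · 1/f₁²)
      ≈⟨ expand₅-cong f₁²-inverse ⟩
    expand₅ 1ₛ
      ≈⟨ expand₅-1ₛ ⟩
    1ₛ ∎

  a≈theta·expand₅ : ∀ {N} → suc K ℕ.+ suc K ℕ.≤ N → a ≈ theta 1 1 N · expand₅ 1/f₁²
  a≈theta·expand₅ {N} 2K+2≤N = begin
    f 1 ⊛ f 1 ⊛ r
      ≈⟨ ⊛≈· (f 1 ⊛ f 1) r ⟩
    (f 1 ⊛ f 1) · r
      ≈⟨ *-congʳ (⊛≈· (f 1) (f 1)) ⟩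
    f 1 · f 1 · r
      ≈⟨ *-congʳ (f₁²≈theta·f₂ 2K+2≤N) ⟩
    theta 1 1 N · f 2 · r
      ≈⟨ *-identityʳ (theta 1 1 N · f 2 · r) ⟨
    theta 1 1 N · f 2 · r · 1ₛ
      ≈⟨ *-congˡ f₅²-inverse ⟨
    -- The reciprocal `r` of the whole denominator is never split. The inserted factor 1 brings the
    -- missing f₅², so that the denominator is complete and cancels `r` at once.
    theta 1 1 N · f 2 · r · (f 5 · f 5 · expand₅ 1/f₁²)
      ≈⟨ solve 5 (λ t x r y e → t :* x :* r :* (y :* y :* e) := t :* e :* (x :* (y :* y) :* r)) R.refl
           (theta 1 1 N) (f 2) r (f 5) (expand₅ 1/f₁²) ⟩
    theta 1 1 N · expand₅ 1/f₁² · (f 2 · (f 5 · f 5) · r)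
      ≈⟨ *-congˡ (*-congʳ (*-congˡ (⊛≈· (f 5) (f 5)))) ⟨
    theta 1 1 N · expand₅ 1/f₁² · (f 2 · (f 5 ⊛ f 5) · r)
      ≈⟨ *-congˡ (*-congʳ (⊛≈· (f 2) (f 5 ⊛ f 5))) ⟨
    theta 1 1 N · expand₅ 1/f₁² · ((f 2 ⊛ (f 5 ⊛ f 5)) · r)
      ≈⟨ *-congˡ (≗⇒≈ (·-recip (f 2 ⊛ (f 5 ⊛ f 5)) refl)) ⟩
    theta 1 1 N · expand₅ 1/f₁² · 1ₛ
      ≈⟨ *-identityʳ (theta 1 1 N · expand₅ 1/f₁²) ⟩
    theta 1 1 N · expand₅ 1/f₁² ∎
    where r = recip (f 2 ⊛ (f 5 ⊛ f 5))

  dissected-· : ∀ x y z p → dissected x y z · expand₅ p ≈ dissected (x · p) (y · p) (z · p)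
  dissected-· x y z p = begin
    dissected x y z · expand₅ p
      ≈⟨ solve 6 (λ x y z a b e → (x :+ (:- (a :* y :+ a :* y)) :+ (b :* z :+ b :* z)) :* e
           := x :* e :+ (:- (a :* (y :* e) :+ a :* (y :* e))) :+ (b :* (z :* e) :+ b :* (z :* e)))
           R.refl (expand₅ x) (expand₅ y) (expand₅ z) (q^ 1) (q^ 4) (expand₅ p) ⟩
    expand₅ x · expand₅ p ⊕ ⊝ (q^ 1 · (expand₅ y · expand₅ p) ⊕ q^ 1 · (expand₅ y · expand₅ p))
      ⊕ (q^ 4 · (expand₅ z · expand₅ p) ⊕ q^ 4 · (expand₅ z · expand₅ p))
      ≈⟨ +-cong (+-cong (expand₅-· x p) (-‿cong (+-cong (*-congˡ (expand₅-· y p)) (*-congˡ (expand₅-· y p)))))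
           (+-cong (*-congˡ (expand₅-· z p)) (*-congˡ (expand₅-· z p))) ⟨
    dissected (x · p) (y · p) (z · p) ∎

  -- The least truncation that `theta≈product` admits.
  N₀ : ℕ
  N₀ = suc K ℕ.+ suc K

  X Y Z : PowerSeries
  X = theta 5 5 N₀ · 1/f₁²
  Y = theta 7 3 N₀ · 1/f₁²
  Z = theta 9 1 N₀ · 1/f₁²

  a≈dissected : a ≈ dissected X Y Z
  a≈dissected = begin
    a
      ≈⟨ a≈theta·expand₅ (ℕ.≤-trans (ℕ.m≤m*n N₀ 5) (ℕ.m≤n+m (N₀ ℕ.* 5) 2)) ⟩
    theta 1 1 (2 ℕ.+ N₀ ℕ.* 5) · expand₅ 1/f₁²
      ≈⟨ *-congʳ (theta-dissection N₀) ⟩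
    dissected (theta 5 5 N₀) (theta 7 3 N₀) (theta 9 1 N₀) · expand₅ 1/f₁²
      ≈⟨ dissected-· (theta 5 5 N₀) (theta 7 3 N₀) (theta 9 1 N₀) 1/f₁² ⟩
    dissected X Y Z ∎

  X-positive : ∀ {k} → k ℕ.≤ K → X k > 0ℤ
  -- The numerals solve 2 + i = u and 3 + j + i = 10 for `quotient₂`, and 1 + i = v and 1 + j + i =
  -- 10 for `quotient₁`. The larger parameter is `u`, because `quotient₂` must leave 1 - q
  -- uncancelled.
  X-positive = theta/f₁²-positive 5 5 N₀ ℕ.≤-refl (quotient₂ 3 4 N₀) (quotient₁ 4 5 N₀)

  Y-positive : ∀ {k} → k ℕ.≤ K → Y k > 0ℤ
  Y-positive = theta/f₁²-positive 7 3 N₀ ℕ.≤-refl (quotient₂ 5 2 N₀) (quotient₁ 2 7 N₀)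

  Z-positive : ∀ {k} → k ℕ.≤ K → Z k > 0ℤ
  Z-positive = theta/f₁²-positive 9 1 N₀ ℕ.≤-refl (quotient₂ 7 0 N₀) (quotient₁ 0 9 N₀)

dissected-coefficient : ∀ x y z k {x₀ y₁ z₄} →
  expand₅ x k ≡ x₀ → (q^ 1 ⊛ expand₅ y) k ≡ y₁ → (q^ 4 ⊛ expand₅ z) k ≡ z₄ →
  dissected x y z k ≡ x₀ + - (y₁ + y₁) + (z₄ + z₄)
dissected-coefficient x y z k refl refl refl = cong₂ (λ s t → expand₅ x k + - (s + s) + (t + t))
  (·-coefficient (q^ 1) (expand₅ y) k) (·-coefficient (q^ 4) (expand₅ z) k)

module _ (x y z : PowerSeries) (n : ℕ) where

  private
    below : ∀ s p r t → {True (r ℕ.<? s)} → {True (s ℕ.+ suc t ℕ.≟ r ℕ.+ 5)} → {True (t ℕ.<? 4)} →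
      (q^ s ⊛ expand₅ p) (r ℕ.+ n ℕ.* 5) ≡ 0ℤ
    below s p r t {r<s} {eq} {t<4} = q^-⊛-expand₅-below s p r t n (toWitness r<s) (toWitness eq) (toWitness t<4)

    above : ∀ s p t → {True (t ℕ.<? 4)} → (q^ s ⊛ expand₅ p) (s ℕ.+ (suc t ℕ.+ n ℕ.* 5)) ≡ 0ℤ
    above s p t {t<4} = q^-⊛-expand₅-above s p t n (toWitness t<4)

    off : ∀ p t → {True (t ℕ.<? 4)} → expand₅ p (suc t ℕ.+ n ℕ.* 5) ≡ 0ℤ
    off p t {t<4} = expand₅-off p t n (toWitness t<4)

  dissected-0 : dissected x y z (n ℕ.* 5) ≡ x n
  dissected-0 = trans
    (dissected-coefficient x y z (n ℕ.* 5) (expand₅-*5 x n) (below 1 y 0 3) (below 4 z 0 0))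
    (trans (ℤ.+-identityʳ (x n + 0ℤ)) (ℤ.+-identityʳ (x n)))

  dissected-1 : dissected x y z (1 ℕ.+ n ℕ.* 5) ≡ - (y n + y n)
  dissected-1 = trans
    (dissected-coefficient x y z (1 ℕ.+ n ℕ.* 5) (off x 0) (q^-⊛-expand₅-on 1 y n) (below 4 z 1 1))
    (trans (ℤ.+-identityʳ (0ℤ + - (y n + y n))) (ℤ.+-identityˡ (- (y n + y n))))

  dissected-2 : dissected x y z (2 ℕ.+ n ℕ.* 5) ≡ 0ℤ
  dissected-2 = dissected-coefficient x y z (2 ℕ.+ n ℕ.* 5) (off x 1) (above 1 y 0) (below 4 z 2 2)

  dissected-3 : dissected x y z (3 ℕ.+ n ℕ.* 5) ≡ 0ℤ
  dissected-3 = dissected-coefficient x y z (3 ℕ.+ n ℕ.* 5) (off x 2) (above 1 y 1) (below 4 z 3 3)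

  dissected-4 : dissected x y z (4 ℕ.+ n ℕ.* 5) ≡ z n + z n
  dissected-4 = trans
    (dissected-coefficient x y z (4 ℕ.+ n ℕ.* 5) (off x 3) (above 1 y 2) (q^-⊛-expand₅-on 4 z n))
    (ℤ.+-identityˡ (z n + z n))

n≤r+n*5 : ∀ r n → n ℕ.≤ r ℕ.+ n ℕ.* 5
n≤r+n*5 r n = ℕ.≤-trans (ℕ.m≤m*n n 5) (ℕ.m≤n+m (n ℕ.* 5) r)

-- The modulus is tied to the index of the coefficient sought, so `X`, `Y` and `Z` change with it.
-- Their positivity is then needed only at n, which never exceeds the index 5n + r.
a-coefficient : ∀ K → let open Reduction K in ∀ {c} → dissected X Y Z K ≡ c → a K ≡ c
a-coefficient K = trans (coefficient (Reduction.a≈dissected K) ℕ.≤-refl)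

5n+r≡r+n*5 : ∀ n r → 5 ℕ.* n ℕ.+ r ≡ r ℕ.+ n ℕ.* 5
5n+r≡r+n*5 n r = trans (ℕ.+-comm (5 ℕ.* n) r) (cong (r ℕ.+_) (ℕ.*-comm 5 n))

theorem5p4 : ∀ (n : ℕ) →
    (a (5 ℕ.* n) > 0ℤ)
    × (a (5 ℕ.* n ℕ.+ 1) < 0ℤ)
    × (a (5 ℕ.* n ℕ.+ 2) ≡ 0ℤ)
    × (a (5 ℕ.* n ℕ.+ 3) ≡ 0ℤ)
    × (a (5 ℕ.* n ℕ.+ 4) > 0ℤ)
theorem5p4 n =
    subst (λ k → a k > 0ℤ) (ℕ.*-comm n 5)
      (subst (_> 0ℤ) (sym (a-coefficient (n ℕ.* 5) (dissected-0 _ _ _ n))) (Reduction.X-positive (n ℕ.* 5) (n≤r+n*5 0 n)))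
  , subst (λ k → a k < 0ℤ) (sym (5n+r≡r+n*5 n 1))
      (subst (_< 0ℤ) (sym (a-coefficient (1 ℕ.+ n ℕ.* 5) (dissected-1 _ _ _ n))) (ℤ.neg-mono-< (double (Reduction.Y-positive (1 ℕ.+ n ℕ.* 5) (n≤r+n*5 1 n)))))
  , trans (cong a (5n+r≡r+n*5 n 2)) (a-coefficient (2 ℕ.+ n ℕ.* 5) (dissected-2 _ _ _ n))
  , trans (cong a (5n+r≡r+n*5 n 3)) (a-coefficient (3 ℕ.+ n ℕ.* 5) (dissected-3 _ _ _ n))
  , subst (λ k → a k > 0ℤ) (sym (5n+r≡r+n*5 n 4))
      (subst (_> 0ℤ) (sym (a-coefficient (4 ℕ.+ n ℕ.* 5) (dissected-4 _ _ _ n))) (double (Reduction.Z-positive (4 ℕ.+ n ℕ.* 5) (n≤r+n*5 4 n))))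
  where
  double : ∀ {i} → i > 0ℤ → i + i > 0ℤ
  double i>0 = ℤ.+-mono-< i>0 i>0
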